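{- Let $n\in\mathbb{N}$, let $\lambda$ be a partition of $n$ and let $U\in\mathrm{SYT}(\lambda)$. For all cells $x\in\lambda$ and for all entries $1\le b\le n$ we have the recursion $$(n-b)\,\Delta_U(b,x)=(n-1)!-\omega_U(b,x)+\sum_{a=1}^{b-1}\Delta_U(a,x).$$
   Context: A partition $\lambda=(\lambda_1\ge\lambda_2\ge\dots)$ of $n$ is identified with its Young diagram $\{(i,j): i\ge 1,\ 1\le j\le\lambda_i\}$ (English convention: row $i$, column $j$). A tableau of shape $\lambda$ is a bijection $T:\lambda\to\{1,\dots,n\}$; $\mathrm{T}(\lambda)$ is the set of all tableaux. $\mathrm{SYT}(\lambda)\subseteq \mathrm{T}(\lambda)$ is the set of standard Young tableaux, i.e. tableaux increasing along rows from left to right and along columns from top to bottom. For a cell $x=(i,j)\in\lambda$ put $N^-(x)=N_\lambda^-(x)=\{(i-1,j),(i,j-1)\}\cap\lambda$ and $N^+(x)=N_\lambda^+(x)=\{(i+1,j),(i,j+1)\}\cap\lambda$. Novelli--Pak--Stoyanovskii algorithm corresponding to $U\in\mathrm{SYT}(\lambda)$: order the cells by $x\prec_U y :\Leftrightarrow U(x)<U(y)$. Given $T\in\mathrm{T}(\lambda)$ set $T_0=T$. If $T_s$ is not a standard Young tableau, let $x$ be the $\prec_U$-maximal cell with $N_\lambda^+(x)\neq\emptyset$ and $T_s(x)>\min\{T_s(y):y\in N_\lambda^+(x)\}$, and let $T_{s+1}$ be obtained from $T_s$ by exchanging the entry $T_s(x)$ with the entry $\min\{T_s(y):y\in N_\lambda^+(x)\}$.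 The process stops at the first tableau $T_r$ which is standard; write $r_U(T)=r$ and $\varphi_U(T)=T_r$. Local exchange numbers: for $1\le a<b\le n$ and $x,y\in\lambda$ let $m_U(a,b,x,y)$ be the number of $T\in\mathrm{T}(\lambda)$ such that for some $1\le i\le r_U(T)$ we have $T_{i-1}(x)=a$, $T_{i-1}(y)=b$, $T_i(x)=b$, $T_i(y)=a$. It is known that this does not depend on the choice of $b>a$, and one writes $m_U(a,x,y)=m_U(a,b,x,y)$ for any $b$ with $a<b\le n$. Signed exit number of the entry $b$ at the cell $x$: $$\Delta_U(b,x)=\sum_{y\in N^-(x)}m_U(b,x,y)-\sum_{y\in N^+(x)}m_U(b,y,x).$$ (For $b=n$ the quantity $\Delta_U(n,x)$ is not defined in this way; the product $(n-n)\,\Delta_U(n,x)$ is read as $0$.) Let $\omega_U(b,x)$ be the number of tableaux $T\in\mathrm{T}(\lambda)$ with $\varphi_U(T)(x)=b$. -}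

module Defs where

open import Data.Empty using (⊥)
open import Data.Fin.Base as Fin using (Fin; zero; suc; toℕ)
import Data.Fin.Properties as Fin
import Data.Fin.Induction as Fin
open import Data.Integer.Base as ℤ using (ℤ; +_; 0ℤ)
open import Data.List.Base
  using (List; []; _∷_; [_]; map; filter; length; lookup; foldr; allFin;
         applyUpTo; cartesianProductWith; concatMap; mapMaybe)
import Data.List.Extrema as Extrema
open import Data.List.Membership.Propositional using (_∈_; find; lose)
open import Data.List.Membership.Propositional.Properties
  using (∈-filter⁺; ∈-filter⁻; ∈-concatMap⁺; ∈-map⁺; ∈-allFin)
open import Data.List.Relation.Unary.All as All using (All)
open import Data.List.Relation.Unary.Any as Any using (Any)
open import Data.List.Relation.Unary.Linked as Linked using (Linked; [-]; _∷_)
open import Data.Maybe.Base as Maybe using (Maybe)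
open import Data.Nat.Base as ℕ using (ℕ; zero; suc; _∸_; _≥_)
open import Data.Nat.ListAction using (sum)
import Data.Nat.Properties as ℕ
open import Data.Product.Base using (Σ; ∃; _×_; _,_; proj₁; proj₂)
open import Data.Sum.Base using (_⊎_; inj₁; inj₂)
open import Data.Vec.Base as Vec using (Vec; []; _∷_)
open import Data.Vec.Relation.Binary.Lex.Strict as Lex using (Lex-<; this; next)
open import Function.Base using (_∘_)
open import Function.Definitions using (Bijective; Injective)
open import Induction.WellFounded using (Acc; acc)
open import Relation.Binary.Definitions using (DecidableEquality; tri<; tri≈; tri>)
open import Relation.Binary.PropositionalEquality
  using (_≡_; _≢_; refl; sym; trans; cong; subst)
open import Relation.Nullary using (¬_; Dec; yes; no; contradiction)
open import Relation.Nullary.Decidable using (map′; dec⇒maybe; _×-dec_; _⊎-dec_; _→-dec_)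
open import Relation.Unary using (Decidable)

record Partition (n : ℕ) : Set where
  field
    parts      : List ℕ
    decreasing : Linked _≥_ parts
    positive   : All (1 ℕ.≤_) parts
    size       : sum parts ≡ n

open Partition public

-- Rows and columns are numbered from 0.
record Cell {n : ℕ} (p : Partition n) : Set where
  constructor ⟨_,_⟩
  field
    rowᶠ : Fin (length (parts p))
    colᶠ : Fin (lookup (parts p) rowᶠ)

open Cell public

-- Fin n encodes {1,…,n}: the entry at x is suc (toℕ (T x)), see entry below.
Filling : ∀ {n} → Partition n → Set
Filling {n} p = Cell p → Fin n

-- All dependent functions on Fin m with values in the given lists.
choices : ∀ {m} {B : Fin m → Set} → (∀ i → List (B i)) → List (∀ i → B i)
choices {zero}  _  = [ (λ ()) ]
choices {suc m} Bs = cartesianProductWith Fin.∀-cons (Bs zero) (choices (Bs ∘ suc))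

module _ {n : ℕ} {p : Partition n} where

  infix 4 _≟_ _⋖_ _⋖?_

  row col : Cell p → ℕ
  row = toℕ ∘ rowᶠ
  col = toℕ ∘ colᶠ

  _≟_ : DecidableEquality (Cell p)
  ⟨ i , j ⟩ ≟ ⟨ i′ , j′ ⟩ with i Fin.≟ i′
  ... | no  i≢i′ = no λ { refl → i≢i′ refl }
  ... | yes refl = map′ (cong ⟨ i ,_⟩) (λ { refl → refl }) (j Fin.≟ j′)

  cells : List (Cell p)
  cells = concatMap (λ i → map ⟨ i ,_⟩ (allFin _)) (allFin _)

  -- y lies directly below x or directly to the right of x.
  _⋖_ : Cell p → Cell p → Set
  x ⋖ y = (row y ≡ suc (row x) × col y ≡ col x)
        ⊎ (row y ≡ row x × col y ≡ suc (col x))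

  _⋖?_ : ∀ x y → Dec (x ⋖ y)
  x ⋖? y = (row y ℕ.≟ suc (row x) ×-dec col y ℕ.≟ col x)
     ⊎-dec (row y ℕ.≟ row x ×-dec col y ℕ.≟ suc (col x))

  N⁺ N⁻ : Cell p → List (Cell p)
  N⁺ x = filter (λ y → x ⋖? y) cells
  N⁻ x = filter (λ y → y ⋖? x) cells

  entry : Filling p → Cell p → ℕ
  entry T x = suc (toℕ (T x))

  IsTableau : Filling p → Set
  IsTableau T = Bijective _≡_ _≡_ T

  IsStandard : Filling p → Set
  IsStandard T = ∀ x y →
    (row x ≡ row y × col x ℕ.< col y) ⊎ (col x ≡ col y × row x ℕ.< row y) →
    T x Fin.< T y

  exchange : Cell p → Cell p → Filling p → Filling p
  exchange x y T z with z ≟ x | z ≟ y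
  ... | yes _ | _     = T y
  ... | no  _ | yes _ = T x
  ... | no  _ | no  _ = T z

Tableau : ∀ {n} → Partition n → Set
Tableau p = Σ (Filling p) IsTableau

SYT : ∀ {n} → Partition n → Set
SYT p = Σ (Filling p) λ U → IsTableau U × IsStandard U

module _ {n : ℕ} {p : Partition n} where

  -- N⁺ x is non-empty, T y is the minimum of T on N⁺ x, and T x exceeds it.
  record Exchangeable (T : Filling p) (x y : Cell p) : Set where
    field
      neighbour : y ∈ N⁺ x
      minimal   : ∀ z → z ∈ N⁺ x → T y Fin.≤ T z
      descent   : T y Fin.< T x

  record NextExchange (U : SYT p) (T : Filling p) (x y : Cell p) : Set where
    field
      exchangeable : Exchangeable T x y
      maximal      : ∀ x′ y′ → Exchangeable T x′ y′ → proj₁ U x′ Fin.≤ proj₁ U x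

  -- The sequence T = T₀, T₁, …, Tᵣ produced by the algorithm.
  data Run (U : SYT p) : Filling p → Set where
    stop : ∀ {T} → IsStandard T → Run U T
    step : ∀ {T} x y → ¬ IsStandard T → NextExchange U T x y →
           Run U (exchange x y T) → Run U T

  final : ∀ {U T} → Run U T → Filling p
  final {T = T} (stop _)   = T
  final (step _ _ _ _ run) = final run

  -- Tᵢ₋₁(x) = a, Tᵢ₋₁(y) = b, Tᵢ(x) = b and Tᵢ(y) = a for some 1 ≤ i ≤ r.
  Exchanges : ∀ {U T} (a b : ℕ) (x y : Cell p) → Run U T → Set
  Exchanges a b x y (stop _) = ⊥
  Exchanges {T = T} a b x y (step x′ y′ _ _ run) =
    (entry T x ≡ a × entry T y ≡ b × entry T′ x ≡ b × entry T′ y ≡ a)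
    ⊎ Exchanges a b x y run
    where T′ = exchange x′ y′ T

  exchanges? : ∀ {U T} a b x y (run : Run U T) → Dec (Exchanges a b x y run)
  exchanges? a b x y (stop _) = no λ ()
  exchanges? {T = T} a b x y (step x′ y′ _ _ run) =
    (entry T x ℕ.≟ a ×-dec entry T y ℕ.≟ b ×-dec
     entry T′ x ℕ.≟ b ×-dec entry T′ y ℕ.≟ a)
    ⊎-dec exchanges? a b x y run
    where T′ = exchange x′ y′ T

-- Every tableau T has a run (`run` below).  Termination: each exchange lowers the
-- word T ∘ U⁻¹ in lexicographic order.
module Termination {n : ℕ} {p : Partition n} where

  module Max = Extrema (Fin.≤-totalOrder n)

  ∈-cells : ∀ x → x ∈ cells {p = p}
  ∈-cells ⟨ i , j ⟩ =
    ∈-concatMap⁺ (λ i → map ⟨ i ,_⟩ (allFin _))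
      (lose (∈-allFin i) (∈-map⁺ ⟨ i ,_⟩ (∈-allFin j)))

  cell-≡ : ∀ (x y : Cell p) → row x ≡ row y → col x ≡ col y → x ≡ y
  cell-≡ ⟨ i , j ⟩ ⟨ i′ , j′ ⟩ r c with Fin.toℕ-injective {i = i} {i′} r
  ... | refl with Fin.toℕ-injective {i = j} {j′} c
  ...   | refl = refl

  ∈N⁺ : ∀ {x y : Cell p} → x ⋖ y → y ∈ N⁺ x
  ∈N⁺ {x} = ∈-filter⁺ (λ y → x ⋖? y) (∈-cells _)

  N⁺-⋖ : ∀ {x y : Cell p} → y ∈ N⁺ x → x ⋖ y
  N⁺-⋖ {x} m = proj₂ (∈-filter⁻ (λ y → x ⋖? y) {xs = cells} m)

  standard-⋖ : ∀ {T : Filling p} → IsStandard T → ∀ {x y} → x ⋖ y → T x Fin.< T y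
  standard-⋖ st (inj₁ (r , c)) = st _ _ (inj₂ (sym c , ℕ.≤-reflexive (sym r)))
  standard-⋖ st (inj₂ (r , c)) = st _ _ (inj₁ (sym r , ℕ.≤-reflexive (sym c)))

  above : ∀ (y : Cell p) {r} → row y ≡ suc r → ∃ λ (z : Cell p) → row z ≡ r × col z ≡ col y
  above ⟨ i , j ⟩ e =
    let i′ , j′ , r , c = go (parts p) (decreasing p) i j e in ⟨ i′ , j′ ⟩ , r , c
    where
    go : ∀ ps → Linked _≥_ ps → (i : Fin (length ps)) (j : Fin (lookup ps i)) →
         ∀ {r} → toℕ i ≡ suc r →
         ∃ λ i′ → ∃ λ (j′ : Fin (lookup ps i′)) → toℕ i′ ≡ r × toℕ j′ ≡ toℕ j
    go (_ ∷ _ ∷ _) (k≥l ∷ _) (suc zero) j refl =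
      zero , Fin.inject≤ j k≥l , refl , Fin.toℕ-inject≤ j k≥l
    go (_ ∷ _ ∷ _) (_ ∷ dec) (suc (suc i)) j refl =
      let i′ , j′ , r , c = go _ dec (suc i) j refl in suc i′ , j′ , cong suc r , c

  left : ∀ (y : Cell p) {c} → col y ≡ suc c → ∃ λ (z : Cell p) → row z ≡ row y × col z ≡ c
  left ⟨ i , j ⟩ {c} e = ⟨ i , Fin.fromℕ< c<k ⟩ , refl , Fin.toℕ-fromℕ< c<k
    where c<k = ℕ.<-trans (ℕ.≤-reflexive (sym e)) (Fin.toℕ<n j)

  ⋖-standard : ∀ {T : Filling p} → (∀ {x y} → x ⋖ y → T x Fin.< T y) → IsStandard T
  ⋖-standard {T} inc x y (inj₁ (r , c<)) = rows (col y) y refl r c<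
    where
    rows : ∀ k y → col y ≡ k → row x ≡ row y → col x ℕ.< k → T x Fin.< T y
    rows (suc k) y cy r (ℕ.s≤s c≤k) with left y cy
    ... | z , rz , cz with ℕ.m≤n⇒m<n∨m≡n c≤k
    ...   | inj₁ c<k  = ℕ.<-trans (rows k z cz (trans r (sym rz)) c<k)
                                  (inc (inj₂ (sym rz , trans cy (cong suc (sym cz)))))
    ...   | inj₂ refl = inc (inj₂ (sym r , cy))
  ⋖-standard {T} inc x y (inj₂ (c , r<)) = columns (row y) y refl c r<
    where
    columns : ∀ k y → row y ≡ k → col x ≡ col y → row x ℕ.< k → T x Fin.< T y
    columns (suc k) y ry c (ℕ.s≤s r≤k) with above y ry
    ... | z , rz , cz with ℕ.m≤n⇒m<n∨m≡n r≤k
    ...   | inj₁ r<k  = ℕ.<-trans (columns k z rz (trans c (sym cz)) r<k)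
                                  (inc (inj₁ (trans ry (cong suc (sym rz)) , sym cz)))
    ...   | inj₂ refl = inc (inj₁ (ry , sym c))

  Violation : Filling p → Cell p → Set
  Violation T x = Any (λ y → T y Fin.< T x) (N⁺ x)

  violation? : ∀ T → Decidable (Violation T)
  violation? T x = Any.any? (λ y → T y Fin.<? T x) (N⁺ x)

  violation-exchangeable : ∀ {T x} → Violation T x → ∃ (Exchangeable T x)
  violation-exchangeable {T} {x} v with find v
  ... | y₀ , y₀∈ , y₀< = y , record
    { neighbour = y∈
    ; minimal   = λ z z∈ → All.lookup (Max.f[argmin]≤f[xs] {f = T} y₀ (N⁺ x)) z∈
    ; descent   = ℕ.≤-<-trans (Max.f[argmin]≤f[⊤] {f = T} y₀ (N⁺ x)) y₀<
    }
    where
    y = Max.argmin T y₀ (N⁺ x)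
    y∈ : y ∈ N⁺ x
    y∈ with Max.argmin-sel T y₀ (N⁺ x)
    ... | inj₁ e = subst (_∈ N⁺ x) (sym e) y₀∈
    ... | inj₂ m = m

  ⋖⇒≢ : ∀ {x y : Cell p} → x ⋖ y → x ≢ y
  ⋖⇒≢ (inj₁ (r , _)) refl = ℕ.1+n≢n (sym r)
  ⋖⇒≢ (inj₂ (_ , c)) refl = ℕ.1+n≢n (sym c)

  search : ∀ (U : SYT p) (T : Filling p) → Injective _≡_ _≡_ T →
           IsStandard T ⊎ (¬ IsStandard T × ∃ λ x → ∃ λ y → NextExchange U T x y)
  search (U , _) T inj with filter (violation? T) cells in eq
  ... | [] = inj₁ (⋖-standard increasing)
    where
    none : ∀ x → ¬ Violation T x
    none x v with subst (x ∈_) eq (∈-filter⁺ (violation? T) (∈-cells x) v)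
    ... | ()
    increasing : ∀ {x y} → x ⋖ y → T x Fin.< T y
    increasing {x} {y} x⋖y with Fin.<-cmp (T x) (T y)
    ... | tri< lt _ _ = lt
    ... | tri≈ _ e _  = contradiction (inj e) (⋖⇒≢ x⋖y)
    ... | tri> _ _ gt = contradiction (lose (∈N⁺ x⋖y) gt) (none x)
  ... | x₀ ∷ xs = inj₂ (not-standard , x , proj₁ ex , record
    { exchangeable = proj₂ ex ; maximal = maximal })
    where
    x = Max.argmax U x₀ xs
    x∈ : x ∈ x₀ ∷ xs
    x∈ with Max.argmax-sel U x₀ xs
    ... | inj₁ e = Any.here e
    ... | inj₂ m = Any.there m
    v : Violation T x
    v = proj₂ (∈-filter⁻ (violation? T) {xs = cells} (subst (x ∈_) (sym eq) x∈))
    ex = violation-exchangeable v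
    not-standard : ¬ IsStandard T
    not-standard st =
      ℕ.<-asym (standard-⋖ st (N⁺-⋖ (Exchangeable.neighbour (proj₂ ex))))
               (Exchangeable.descent (proj₂ ex))
    maximal : ∀ x′ y′ → Exchangeable T x′ y′ → U x′ Fin.≤ U x
    maximal x′ y′ e
      with subst (x′ ∈_) eq (∈-filter⁺ (violation? T) (∈-cells x′)
             (lose (Exchangeable.neighbour e) (Exchangeable.descent e)))
    ... | Any.here refl = Max.f[⊥]≤f[argmax] {f = U} x₀ xs
    ... | Any.there m   = All.lookup (Max.f[xs]≤f[argmax] {f = U} x₀ xs) m

  exchange-injective : ∀ x y {T : Filling p} → Injective _≡_ _≡_ T →
                       Injective _≡_ _≡_ (exchange x y T)
  exchange-injective x y inj {z} {w} e with z ≟ x | z ≟ y | w ≟ x | w ≟ y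
  ... | yes z≡x | _       | yes w≡x | _       = trans z≡x (sym w≡x)
  ... | yes z≡x | _       | no  w≢x | yes w≡y = trans z≡x (trans (sym (inj e)) (sym w≡y))
  ... | yes z≡x | _       | no  w≢x | no  w≢y = contradiction (sym (inj e)) w≢y
  ... | no  z≢x | yes z≡y | yes w≡x | _       = trans z≡y (trans (sym (inj e)) (sym w≡x))
  ... | no  z≢x | yes z≡y | no  w≢x | yes w≡y = trans z≡y (sym w≡y)
  ... | no  z≢x | yes z≡y | no  w≢x | no  w≢y = contradiction (sym (inj e)) w≢x
  ... | no  z≢x | no  z≢y | yes w≡x | _       = contradiction (inj e) z≢y
  ... | no  z≢x | no  z≢y | no  w≢x | yes w≡y = contradiction (inj e) z≢x
  ... | no  z≢x | no  z≢y | no  w≢x | no  w≢y = inj e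

  exchange-left : ∀ x y (T : Filling p) → exchange x y T x ≡ T y
  exchange-left x y T with x ≟ x | x ≟ y
  ... | yes _  | _ = refl
  ... | no x≢x | _ = contradiction refl x≢x

  exchange-other : ∀ x y (T : Filling p) z → z ≢ x → z ≢ y → exchange x y T z ≡ T z
  exchange-other x y T z z≢x z≢y with z ≟ x | z ≟ y
  ... | yes z≡x | _       = contradiction z≡x z≢x
  ... | no  _   | yes z≡y = contradiction z≡y z≢y
  ... | no  _   | no  _   = refl

  _≺_ : ∀ {m} → Vec (Fin n) m → Vec (Fin n) m → Set
  _≺_ = Lex-< _≡_ Fin._<_

  ≺-tabulate : ∀ {m} (f g : Fin m → Fin n) k → (∀ j → j Fin.< k → f j ≡ g j) →
               f k Fin.< g k → Vec.tabulate f ≺ Vec.tabulate g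
  ≺-tabulate f g zero    eq lt = this lt refl
  ≺-tabulate f g (suc k) eq lt =
    next (eq zero (ℕ.s≤s ℕ.z≤n))
         (≺-tabulate (f ∘ suc) (g ∘ suc) k (λ j j<k → eq (suc j) (ℕ.s≤s j<k)) lt)

  module _ (U : SYT p) where

    private
      u     = proj₁ U
      u-inj = proj₁ (proj₁ (proj₂ U))
      u-sur = proj₂ (proj₁ (proj₂ U))

    u⁻¹ : Fin n → Cell p
    u⁻¹ k = proj₁ (u-sur k)

    u-u⁻¹ : ∀ k → u (u⁻¹ k) ≡ k
    u-u⁻¹ k = proj₂ (u-sur k) refl

    u⁻¹-u : ∀ x → u⁻¹ (u x) ≡ x
    u⁻¹-u x = u-inj (u-u⁻¹ (u x))

    word : Filling p → Vec (Fin n) n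
    word T = Vec.tabulate (T ∘ u⁻¹)

    exchange-≺ : ∀ {T x y} → Exchangeable T x y → word (exchange x y T) ≺ word T
    exchange-≺ {T} {x} {y} e = ≺-tabulate _ _ (u x) unchanged lowered
      where
      ux<uy = standard-⋖ (proj₂ (proj₂ U)) (N⁺-⋖ (Exchangeable.neighbour e))
      unchanged : ∀ k → k Fin.< u x → exchange x y T (u⁻¹ k) ≡ T (u⁻¹ k)
      unchanged k k<ux = exchange-other x y T (u⁻¹ k)
        (λ { refl → ℕ.<-irrefl (cong toℕ (sym (u-u⁻¹ k))) k<ux })
        (λ { refl → ℕ.<-irrefl (cong toℕ (sym (u-u⁻¹ k))) (ℕ.<-trans k<ux ux<uy) })
      lowered : exchange x y T (u⁻¹ (u x)) Fin.< T (u⁻¹ (u x))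
      lowered rewrite u⁻¹-u x | exchange-left x y T = Exchangeable.descent e

    run-acc : ∀ T → Injective _≡_ _≡_ T → Acc _≺_ (word T) → Run U T
    run-acc T inj (acc rs) with search U T inj
    ... | inj₁ st = stop st
    ... | inj₂ (¬st , x , y , e) =
      step x y ¬st e
        (run-acc (exchange x y T) (exchange-injective x y inj)
                 (rs (exchange-≺ (NextExchange.exchangeable e))))

module _ {n : ℕ} {p : Partition n} where

  run : ∀ (U : SYT p) ((T , _) : Tableau p) → Run U T
  run U (T , inj , _) =
    Termination.run-acc U T inj
      (Lex.<-wellFounded trans (λ { refl lt → lt }) Fin.<-wellFounded _)

  φ : SYT p → Tableau p → Filling p
  φ U T = final (run U T)

  allCells? : ∀ {P : Cell p → Set} → Decidable P → Dec (∀ x → P x)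
  allCells? P? = map′ (λ f x → f (rowᶠ x) (colᶠ x)) (λ f i j → f ⟨ i , j ⟩)
    (Fin.all? λ i → Fin.all? λ j → P? ⟨ i , j ⟩)

  anyCell? : ∀ {P : Cell p → Set} → Decidable P → Dec (∃ P)
  anyCell? P? = map′ (λ (i , j , Pij) → ⟨ i , j ⟩ , Pij) (λ (x , Px) → rowᶠ x , colᶠ x , Px)
    (Fin.any? λ i → Fin.any? λ j → P? ⟨ i , j ⟩)

  isTableau? : Decidable (IsTableau {p = p})
  isTableau? T =
    map′ (λ f {x} {y} → f x y) (λ inj x y → inj {x} {y})
      (allCells? λ x → allCells? λ y → (T x Fin.≟ T y) →-dec (x ≟ y))
    ×-dec
    map′ (λ f k → proj₁ (f k) , λ { refl → proj₂ (f k) }) (λ sur k → proj₁ (sur k) , proj₂ (sur k) refl)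
      (Fin.all? λ k → anyCell? λ x → T x Fin.≟ k)

-- Lists every filling exactly once, up to pointwise equality.
fillings : ∀ {n} (p : Partition n) → List (Filling p)
fillings {n} p = map (λ f x → f (rowᶠ x) (colᶠ x)) (choices λ i → choices λ j → allFin n)

tableaux : ∀ {n} (p : Partition n) → List (Tableau p)
tableaux p = mapMaybe (λ T → Maybe.map (T ,_) (dec⇒maybe (isTableau? T))) (fillings p)

sumℤ : List ℤ → ℤ
sumℤ = foldr ℤ._+_ 0ℤ

module _ {n : ℕ} {p : Partition n} (U : SYT p) where

  exchangeNumber : (a b : ℕ) (x y : Cell p) → ℕ
  exchangeNumber a b x y =
    length (filter (λ T → exchanges? a b x y (run U T)) (tableaux p))

  -- exchangeNumber a b x y is the same for all a < b ≤ n; b = a + 1 is the choice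
  -- that is admissible for every a < n.
  m : (a : ℕ) (x y : Cell p) → ℕ
  m a x y = exchangeNumber a (suc a) x y

  -- As no entry equals n + 1, Δ n x = 0.
  Δ : (b : ℕ) (x : Cell p) → ℤ
  Δ b x = + sum (map (λ y → m b x y) (N⁻ x)) ℤ.- + sum (map (λ y → m b y x) (N⁺ x))

  ω : (b : ℕ) (x : Cell p) → ℕ
  ω b x = length (filter (λ T → entry (φ U T) x ℕ.≟ b) (tableaux p))

{-# OPTIONS --safe #-}
module Submission where

-- Fix a cell x and an entry b and follow one run of the algorithm.  Every exchange that
-- moves b into x or out of x involves exactly one other entry c and one neighbour of x, so
-- the number of exits minus the number of entries of b at x is the difference between
-- [T x = b] at the beginning and at the end of the run (`balance`).  Summed over all
-- tableaux T, the beginning contributes (n - 1)! (`count-entry`) and the end contributes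
-- ω b x (`balance-total`).  In an exchange the smaller entry moves up or left, which decides
-- for c > b and for c < b which neighbours of x occur: the partners c > b contribute the
-- summands of Δ b x, and the partners c < b those of the sum of the - Δ c x.
--
-- The factor n - b is the number of partners c > b.  It appears because the exchange number
-- of a < b at given cells does not depend on b (`exchangeNumber-≡-m`).  To see this, compare
-- the runs from T and from T with the entries b and b + 1 transposed.  The entry b slides
-- down only in the phase that starts at its initial cell.  Before b slides in the one run
-- and b + 1 in the other, that initial cell is not involved, and comparisons of the other
-- entries are not affected by the transposition.  During the slide the entries met by b
-- increase, so up to the exchange with a only entries at most a have been met, and these lie
-- below both b and b + 1.  Hence the two runs make the same exchanges up to that point
-- (`exchanges-transpose`).
--
-- The facts about phases follow from the invariant `Sliding`.  They also show that a pair
-- of entries a < b is exchanged at given cells at most once in a run (`exchanges-once`), so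
-- that counting tableaux is the same as counting exchanges.

open import Defs
open import Data.Bool.Base using (true; false; if_then_else_)
open import Data.Fin.Base as Fin using (Fin; zero; suc; toℕ; fromℕ<; punchOut)
open import Data.Fin.Permutation.Components using (transpose; transpose-inverse)
import Data.Fin.Properties as Fin
open import Data.Integer using (+_; _+_; _-_; _*_)
import Data.Integer.Properties as ℤ
open import Data.Integer.Solver using () renaming (module +-*-Solver to ℤS)
open import Data.List using
  (List; []; _∷_; map; applyUpTo; _++_; filter; length; lookup; allFin; cartesianProductWith;
   mapMaybe)
open import Data.List.Membership.Propositional using (_∈_; lose)
open import Data.List.Membership.Propositional.Properties
  using (∈-allFin; ∈-map⁻; ∈-filter⁺; ∈-applyUpTo⁺; ∈-applyUpTo⁻)
open import Data.List.Properties
  using (map-++; map-cong; map-cong-local; map-∘; length-tabulate; length-applyUpTo)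
open import Data.List.Relation.Unary.All as All using (All)
import Data.List.Relation.Unary.All.Properties as All
open import Data.List.Relation.Unary.AllPairs as AllPairs using ()
import Data.List.Relation.Unary.AllPairs.Properties as AllPairs
open import Data.List.Relation.Unary.Any using (here; there)
open import Data.List.Relation.Unary.Unique.Propositional using (Unique)
import Data.List.Relation.Unary.Unique.Propositional.Properties as Unique
open import Data.Maybe.Base as Maybe using (Maybe; just; nothing; maybe′)
open import Data.Nat using (ℕ; zero; suc; _≤_; _<_; _∸_; _!; s≤s)
import Data.Nat as ℕ
open import Data.Nat.ListAction using (sum)
open import Data.Nat.ListAction.Properties using (sum-++)
import Data.Nat.Properties as ℕ
open import Data.Nat.Solver using (module +-*-Solver)
open +-*-Solver using (solve; _:+_; _:*_; _:=_; con)
open import Data.Product using (Σ; ∃; _×_; _,_; proj₁; proj₂)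
open import Data.Sum using (_⊎_; inj₁; inj₂)
open import Function using (_∘_; id; case_of_)
open import Function.Definitions using (Injective)
open import Relation.Binary.Definitions using (DecidableEquality; tri<; tri≈; tri>)
open import Relation.Binary.PropositionalEquality
open import Relation.Nullary using (¬_; Dec; yes; no; does; contradiction)
open import Relation.Nullary.Decidable
  using (_×-dec_; _⊎-dec_; _→-dec_; ¬?; dec-true; dec-false; dec⇒maybe)
open import Relation.Unary using (Decidable)

private variable
  A B C : Set
  P Q : Set

-- Indicators and finite sums

-- The indicator of a decidable proposition.
⟦_⟧ : Dec P → ℕ
⟦ d ⟧ = if does d then 1 else 0

⟦⟧-true : (d : Dec P) → P → ⟦ d ⟧ ≡ 1
⟦⟧-true d p rewrite dec-true d p = refl

⟦⟧-false : (d : Dec P) → ¬ P → ⟦ d ⟧ ≡ 0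
⟦⟧-false d ¬p rewrite dec-false d ¬p = refl

⟦⟧-cong : (d : Dec P) (e : Dec Q) → (P → Q) → (Q → P) → ⟦ d ⟧ ≡ ⟦ e ⟧
⟦⟧-cong (yes p) e f g = sym (⟦⟧-true e (f p))
⟦⟧-cong (no ¬p) e f g = sym (⟦⟧-false e (¬p ∘ g))

⟦⟧-intro : (d : Dec P) {s : ℕ} → (P → s ≡ 1) → (¬ P → s ≡ 0) → s ≡ ⟦ d ⟧
⟦⟧-intro (yes p) one zer = one p
⟦⟧-intro (no ¬p) one zer = zer ¬p

⟦⟧-*-cong : (d : Dec P) {s t : ℕ} → (P → s ≡ t) → ⟦ d ⟧ ℕ.* s ≡ ⟦ d ⟧ ℕ.* t
⟦⟧-*-cong (yes p) e = cong (ℕ._+ 0) (e p)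
⟦⟧-*-cong (no _)  e = refl

⟦⟧-× : (d : Dec P) (e : Dec Q) → ⟦ d ×-dec e ⟧ ≡ ⟦ d ⟧ ℕ.* ⟦ e ⟧
⟦⟧-× d e with does d | does e
... | true  | true  = refl
... | true  | false = refl
... | false | _     = refl

⟦⟧-⊎ : (d : Dec P) (e : Dec Q) → (P → ¬ Q) → ⟦ d ⊎-dec e ⟧ ≡ ⟦ d ⟧ ℕ.+ ⟦ e ⟧
⟦⟧-⊎ (yes p) e p⇒¬q = cong suc (sym (⟦⟧-false e (p⇒¬q p)))
⟦⟧-⊎ (no _)  e _    = refl

⟦⟧-¬ : (d : Dec P) → ⟦ ¬? d ⟧ ℕ.+ ⟦ d ⟧ ≡ 1
⟦⟧-¬ d with does d
... | true  = refl
... | false = refl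

-- The sum of f over the members of a list, counted with multiplicity.
∑ : List A → (A → ℕ) → ℕ
∑ xs f = sum (map f xs)

∑-cong : (xs : List A) {f g : A → ℕ} → (∀ x → f x ≡ g x) → ∑ xs f ≡ ∑ xs g
∑-cong xs e = cong sum (map-cong e xs)

∑-cong-∈ : {xs : List A} {f g : A → ℕ} → (∀ {x} → x ∈ xs → f x ≡ g x) → ∑ xs f ≡ ∑ xs g
∑-cong-∈ e = cong sum (map-cong-local (All.tabulate e))

∑-const : (xs : List A) (c : ℕ) → ∑ xs (λ _ → c) ≡ length xs ℕ.* c
∑-const []       c = refl
∑-const (x ∷ xs) c = cong (c ℕ.+_) (∑-const xs c)

∑-zero : (xs : List A) {f : A → ℕ} → (∀ x → f x ≡ 0) → ∑ xs f ≡ 0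
∑-zero xs e = trans (∑-cong xs e) (trans (∑-const xs 0) (ℕ.*-zeroʳ (length xs)))

∑-+ : (xs : List A) (f g : A → ℕ) → ∑ xs (λ x → f x ℕ.+ g x) ≡ ∑ xs f ℕ.+ ∑ xs g
∑-+ []       f g = refl
∑-+ (x ∷ xs) f g rewrite ∑-+ xs f g =
  solve 4 (λ a b c d → (a :+ b) :+ (c :+ d) := (a :+ c) :+ (b :+ d)) refl (f x) (g x) (∑ xs f) (∑ xs g)

∑-*ˡ : (xs : List A) (c : ℕ) (f : A → ℕ) → ∑ xs (λ x → c ℕ.* f x) ≡ c ℕ.* ∑ xs f
∑-*ˡ []       c f = sym (ℕ.*-zeroʳ c)
∑-*ˡ (x ∷ xs) c f rewrite ∑-*ˡ xs c f = sym (ℕ.*-distribˡ-+ c (f x) (∑ xs f))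

∑-*ʳ : (xs : List A) (c : ℕ) (f : A → ℕ) → ∑ xs (λ x → f x ℕ.* c) ≡ ∑ xs f ℕ.* c
∑-*ʳ xs c f = trans (∑-cong xs λ x → ℕ.*-comm (f x) c) (trans (∑-*ˡ xs c f) (ℕ.*-comm c _))

∑-swap : (xs : List A) (ys : List B) (f : A → B → ℕ) →
         ∑ xs (λ x → ∑ ys (f x)) ≡ ∑ ys (λ y → ∑ xs (λ x → f x y))
∑-swap []       ys f = sym (∑-zero ys λ _ → refl)
∑-swap (x ∷ xs) ys f = trans (cong (∑ ys (f x) ℕ.+_) (∑-swap xs ys f)) (sym (∑-+ ys (f x) _))

∑-map : (h : A → B) (xs : List A) (f : B → ℕ) → ∑ (map h xs) f ≡ ∑ xs (f ∘ h)
∑-map h xs f = cong sum (sym (map-∘ xs))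

∑-cartesianProductWith : (h : A → B → C) (xs : List A) (ys : List B) (f : C → ℕ) →
  ∑ (cartesianProductWith h xs ys) f ≡ ∑ xs (λ x → ∑ ys (λ y → f (h x y)))
∑-cartesianProductWith h []       ys f = refl
∑-cartesianProductWith h (x ∷ xs) ys f = begin
  sum (map f (map (h x) ys ++ cartesianProductWith h xs ys))
    ≡⟨ cong sum (map-++ f (map (h x) ys) _) ⟩
  sum (map f (map (h x) ys) ++ map f (cartesianProductWith h xs ys))
    ≡⟨ sum-++ (map f (map (h x) ys)) _ ⟩
  ∑ (map (h x) ys) f ℕ.+ ∑ (cartesianProductWith h xs ys) f
    ≡⟨ cong₂ ℕ._+_ (∑-map (h x) ys f) (∑-cartesianProductWith h xs ys f) ⟩
  ∑ ys (f ∘ h x) ℕ.+ ∑ xs (λ x → ∑ ys (λ y → f (h x y))) ∎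
  where open ≡-Reasoning

length-filter-∑ : {P : A → Set} (P? : Decidable P) (xs : List A) →
                  length (filter P? xs) ≡ ∑ xs (λ x → ⟦ P? x ⟧)
length-filter-∑ P? []       = refl
length-filter-∑ P? (x ∷ xs) with does (P? x)
... | true  = cong suc (length-filter-∑ P? xs)
... | false = length-filter-∑ P? xs

-- A list without repetitions contains exactly one solution of P, if it contains one and there
-- is no other.
∑-unique : {P : A → Set} (P? : Decidable P) {xs : List A} → Unique xs → ∀ {x} → x ∈ xs →
           P x → (∀ {y} → P y → y ≡ x) → ∑ xs (λ y → ⟦ P? y ⟧) ≡ 1
∑-unique P? {x ∷ xs} (x∉ AllPairs.∷ _) (here refl) px only =
  cong₂ ℕ._+_ (⟦⟧-true (P? x) px)
    (trans (∑-cong-∈ λ {y} y∈ → ⟦⟧-false (P? y) λ py → All.lookup x∉ y∈ (sym (only py)))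
           (∑-zero xs λ _ → refl))
∑-unique P? {y ∷ xs} (y∉ AllPairs.∷ uq) (there x∈) px only =
  cong₂ ℕ._+_ (⟦⟧-false (P? y) λ py → All.lookup y∉ x∈ (only py)) (∑-unique P? uq x∈ px only)

-- If D c y has the single solution (c₀ , y₀) when K holds and none otherwise, then counting
-- solutions gives the indicator of K.
∑∑-unique : {K : Set} {D : A → B → Set} (K? : Dec K) (D? : ∀ c y → Dec (D c y)) →
  DecidableEquality A → {xs : List A} {ys : List B} → Unique xs → Unique ys →
  (c₀ : A) (y₀ : B) → (∀ {c y} → c ∈ xs → D c y → K × c ≡ c₀ × y ≡ y₀) →
  (K → D c₀ y₀ × c₀ ∈ xs × y₀ ∈ ys) →
  ∑ xs (λ c → ∑ ys (λ y → ⟦ D? c y ⟧)) ≡ ⟦ K? ⟧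
∑∑-unique (no ¬k) D? _ {xs} {ys} _ _ c₀ y₀ to _ =
  trans (∑-cong-∈ λ {c} c∈ → ∑-zero ys λ y → ⟦⟧-false (D? c y) (¬k ∘ proj₁ ∘ to c∈))
        (∑-zero xs λ _ → refl)
∑∑-unique (yes k) D? _≟_ {xs} {ys} xs! ys! c₀ y₀ to from =
  let d , c₀∈ , y₀∈ = from k in
  trans (∑-cong-∈ λ {c} c∈ → column c c∈ d y₀∈) (∑-unique (_≟ c₀) xs! c₀∈ refl id)
  where
  column : ∀ c → c ∈ xs → _ → y₀ ∈ ys → ∑ ys (λ y → ⟦ D? c y ⟧) ≡ ⟦ c ≟ c₀ ⟧
  column c c∈ d y₀∈ with c ≟ c₀
  ... | yes refl = ∑-unique (D? c) ys! y₀∈ d (λ d′ → proj₂ (proj₂ (to c∈ d′)))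
  ... | no c≢c₀  = ∑-zero ys λ y → ⟦⟧-false (D? c y) (c≢c₀ ∘ proj₁ ∘ proj₂ ∘ to c∈)

-- Double counting: if R relates every element of A to exactly one member of ys and every
-- element of B to exactly one member of xs, then functions that agree along R have equal sums.
∑-correspondence : {R : A → B → Set} (R? : ∀ a b → Dec (R a b)) (xs : List A) (ys : List B)
  {f : A → ℕ} {g : B → ℕ} →
  (∀ a → ∑ ys (λ b → ⟦ R? a b ⟧) ≡ 1) → (∀ b → ∑ xs (λ a → ⟦ R? a b ⟧) ≡ 1) →
  (∀ {a b} → R a b → f a ≡ g b) → ∑ xs f ≡ ∑ ys g
∑-correspondence R? xs ys {f} {g} rows columns agree = begin
  ∑ xs f
    ≡⟨ ∑-cong xs (λ a → weigh ys (f a) (rows a)) ⟨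
  ∑ xs (λ a → ∑ ys (λ b → f a ℕ.* ⟦ R? a b ⟧))  ≡⟨ ∑-swap xs ys _ ⟩
  ∑ ys (λ b → ∑ xs (λ a → f a ℕ.* ⟦ R? a b ⟧))
    ≡⟨ ∑-cong ys (λ b → trans (∑-cong xs (λ a → transfer a b)) (weigh xs (g b) (columns b))) ⟩
  ∑ ys g ∎
  where
  open ≡-Reasoning
  weigh : (zs : List C) (c : ℕ) {w : C → ℕ} → ∑ zs w ≡ 1 → ∑ zs (λ z → c ℕ.* w z) ≡ c
  weigh zs c e = trans (∑-*ˡ zs c _) (trans (cong (c ℕ.*_) e) (ℕ.*-identityʳ c))
  transfer : ∀ a b → f a ℕ.* ⟦ R? a b ⟧ ≡ g b ℕ.* ⟦ R? a b ⟧
  transfer a b with R? a b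
  ... | yes r = cong (ℕ._* 1) (agree r)
  ... | no _  = trans (ℕ.*-zeroʳ (f a)) (sym (ℕ.*-zeroʳ (g b)))

transpose-left : ∀ {n} (i j : Fin n) → transpose i j i ≡ j
transpose-left i j rewrite dec-true (i Fin.≟ i) refl = refl

-- Counting tableaux

-- The list of choices contains exactly one function whose values all satisfy R, if each list
-- of values contains exactly one element that does.
choices-once : ∀ {m} {B : Fin m → Set} {R : ∀ i → B i → Set} (R? : ∀ i y → Dec (R i y))
  (Bs : ∀ i → List (B i)) → (∀ i → ∑ (Bs i) (λ y → ⟦ R? i y ⟧) ≡ 1) →
  ∑ (choices Bs) (λ g → ⟦ Fin.all? (λ i → R? i (g i)) ⟧) ≡ 1
choices-once {zero}      R? Bs once = refl
choices-once {suc m} {B} {R} R? Bs once = begin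
  ∑ (choices Bs) (λ g → ⟦ Fin.all? (λ i → R? i (g i)) ⟧)
    ≡⟨ ∑-cartesianProductWith (Fin.∀-cons {P = B}) (Bs zero) (choices (Bs ∘ suc)) _ ⟩
  ∑ (Bs zero) (λ y → ∑ (choices (Bs ∘ suc)) (λ g → ⟦ Fin.all? (λ i → R? i (Fin.∀-cons {P = B} y g i)) ⟧))
    ≡⟨ ∑-cong (Bs zero) (λ y → trans (∑-cong (choices (Bs ∘ suc)) (split y))
         (∑-*ˡ (choices (Bs ∘ suc)) ⟦ R? zero y ⟧ _)) ⟩
  ∑ (Bs zero) (λ y → ⟦ R? zero y ⟧ ℕ.*
     ∑ (choices (Bs ∘ suc)) (λ g → ⟦ Fin.all? (λ i → R? (suc i) (g i)) ⟧))
    ≡⟨ ∑-cong (Bs zero) (λ y → trans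
         (cong (⟦ R? zero y ⟧ ℕ.*_) (choices-once (λ i → R? (suc i)) (Bs ∘ suc) (once ∘ suc)))
         (ℕ.*-identityʳ _)) ⟩
  ∑ (Bs zero) (λ y → ⟦ R? zero y ⟧)
    ≡⟨ once zero ⟩
  1 ∎
  where
  open ≡-Reasoning
  split : ∀ y g → ⟦ Fin.all? (λ i → R? i (Fin.∀-cons {P = B} y g i)) ⟧ ≡
                  ⟦ R? zero y ⟧ ℕ.* ⟦ Fin.all? (λ i → R? (suc i) (g i)) ⟧
  split y g = trans
    (⟦⟧-cong (Fin.all? λ i → R? i (Fin.∀-cons {P = B} y g i))
       (R? zero y ×-dec Fin.all? (λ i → R? (suc i) (g i)))
       (λ r → r zero , λ i → r (suc i))
       (λ { (r , rs) zero → r ; (r , rs) (suc i) → rs i }))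
    (⟦⟧-× (R? zero y) (Fin.all? λ i → R? (suc i) (g i)))

∑-allFin-≡ : ∀ {n} (i : Fin n) {P : Fin n → Set} (P? : Decidable P) → P i → (∀ {j} → P j → j ≡ i) →
             ∑ (allFin n) (λ j → ⟦ P? j ⟧) ≡ 1
∑-allFin-≡ i P? = ∑-unique P? (Unique.allFin⁺ _) (∈-allFin i)

length-allFin : ∀ n → length (allFin n) ≡ n
length-allFin n = length-tabulate {n = n} id

module _ {n : ℕ} where

  injective? : ∀ {k} (g : Fin k → Fin n) → Dec (∀ i j → g i ≡ g j → i ≡ j)
  injective? g = Fin.all? λ i → Fin.all? λ j → (g i Fin.≟ g j) →-dec (i Fin.≟ j)

  -- Membership in the image of g.
  image? : ∀ {k} (g : Fin k → Fin n) i → Dec (∃ λ j → g j ≡ i)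
  image? g i = Fin.any? λ j → g j Fin.≟ i

  -- All functions from Fin k to Fin n.
  functions : ∀ k → List (Fin k → Fin n)
  functions k = choices {B = λ _ → Fin n} λ _ → allFin n

  ∑-image : ∀ {k} (g : Fin k → Fin n) → (∀ i j → g i ≡ g j → i ≡ j) →
            ∑ (allFin n) (λ i → ⟦ image? g i ⟧) ≡ k
  ∑-image {k} g inj = begin
    ∑ (allFin n) (λ i → ⟦ image? g i ⟧)                       ≡⟨ ∑-cong (allFin n) preimage ⟩
    ∑ (allFin n) (λ i → ∑ (allFin k) (λ j → ⟦ g j Fin.≟ i ⟧)) ≡⟨ ∑-swap (allFin n) (allFin k) _ ⟩
    ∑ (allFin k) (λ j → ∑ (allFin n) (λ i → ⟦ g j Fin.≟ i ⟧))
      ≡⟨ ∑-cong (allFin k) (λ j → ∑-allFin-≡ (g j) (g j Fin.≟_) refl sym) ⟩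
    ∑ (allFin k) (λ _ → 1)                                    ≡⟨ ∑-const (allFin k) 1 ⟩
    length (allFin k) ℕ.* 1                                   ≡⟨ ℕ.*-identityʳ _ ⟩
    length (allFin k)                                         ≡⟨ length-allFin k ⟩
    k ∎
    where
    open ≡-Reasoning
    preimage : ∀ i → ⟦ image? g i ⟧ ≡ ∑ (allFin k) (λ j → ⟦ g j Fin.≟ i ⟧)
    preimage i = sym (⟦⟧-intro (image? g i)
      (λ (j , e) → ∑-allFin-≡ j (λ j → g j Fin.≟ i) e (λ e′ → inj _ _ (trans e′ (sym e))))
      (λ ¬image → ∑-zero (allFin k) λ j → ⟦⟧-false (g j Fin.≟ i) (¬image ∘ (j ,_))))

  ∑-outside : ∀ {k} (g : Fin k → Fin n) → (∀ i j → g i ≡ g j → i ≡ j) →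
              ∑ (allFin n) (λ i → ⟦ ¬? (image? g i) ⟧) ≡ n ∸ k
  ∑-outside {k} g inj = begin
    ∑ (allFin n) out                                     ≡⟨ ℕ.m+n∸n≡m _ k ⟨
    ∑ (allFin n) out ℕ.+ k ∸ k
      ≡⟨ cong (λ s → ∑ (allFin n) out ℕ.+ s ∸ k) (∑-image g inj) ⟨
    ∑ (allFin n) out ℕ.+ ∑ (allFin n) (λ i → ⟦ image? g i ⟧) ∸ k
      ≡⟨ cong (_∸ k) (∑-+ (allFin n) out _) ⟨
    ∑ (allFin n) (λ i → out i ℕ.+ ⟦ image? g i ⟧) ∸ k
      ≡⟨ cong (_∸ k) (∑-cong (allFin n) (λ i → ⟦⟧-¬ (image? g i))) ⟩
    ∑ (allFin n) (λ _ → 1) ∸ k                           ≡⟨ cong (_∸ k) (∑-const (allFin n) 1) ⟩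
    length (allFin n) ℕ.* 1 ∸ k                          ≡⟨ cong (_∸ k) (ℕ.*-identityʳ _) ⟩
    length (allFin n) ∸ k                                ≡⟨ cong (_∸ k) (length-allFin n) ⟩
    n ∸ k ∎
    where
    open ≡-Reasoning
    out = λ i → ⟦ ¬? (image? g i) ⟧

  -- There are n! / (n - k)! injections from Fin k to Fin n: an injection on k points extends to
  -- one more point in n - k ways.
  injections : ∀ k → k ≤ n → ∑ (functions k) (λ g → ⟦ injective? g ⟧) ℕ.* (n ∸ k) ! ≡ n !
  injections zero    _   = ℕ.+-identityʳ (n !)
  injections (suc k) k<n = begin
    ∑ (functions (suc k)) (λ g → ⟦ injective? g ⟧) ℕ.* (n ∸ suc k) !
      ≡⟨ cong (ℕ._* (n ∸ suc k) !) extend ⟩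
    ∑ (functions k) (λ g → ⟦ injective? g ⟧) ℕ.* (n ∸ k) ℕ.* (n ∸ suc k) !
      ≡⟨ ℕ.*-assoc (∑ (functions k) (λ g → ⟦ injective? g ⟧)) (n ∸ k) _ ⟩
    ∑ (functions k) (λ g → ⟦ injective? g ⟧) ℕ.* ((n ∸ k) ℕ.* (n ∸ suc k) !)
      ≡⟨ cong (∑ (functions k) (λ g → ⟦ injective? g ⟧) ℕ.*_) (factorial k<n) ⟩
    ∑ (functions k) (λ g → ⟦ injective? g ⟧) ℕ.* (n ∸ k) !
      ≡⟨ injections k (ℕ.<⇒≤ k<n) ⟩
    n ! ∎
    where
    open ≡-Reasoning
    factorial : ∀ {n} → k < n → (n ∸ k) ℕ.* (n ∸ suc k) ! ≡ (n ∸ k) !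
    factorial (s≤s k≤n) rewrite ℕ.+-∸-assoc 1 k≤n = refl
    cons : ∀ i g → ⟦ injective? (Fin.∀-cons {P = λ _ → Fin n} i g) ⟧ ≡
                   ⟦ injective? g ⟧ ℕ.* ⟦ ¬? (image? {k} g i) ⟧
    cons i g = trans
      (⟦⟧-cong (injective? (Fin.∀-cons {P = λ _ → Fin n} i g)) (injective? g ×-dec ¬? (image? g i))
        (λ inj → (λ a b e → Fin.suc-injective (inj (suc a) (suc b) e)) ,
                 λ (j , e) → case inj (suc j) zero e of λ ())
        (λ (inj , new) → λ where
          zero    zero    _ → refl
          zero    (suc b) e → contradiction (b , sym e) new
          (suc a) zero    e → contradiction (a , e) new
          (suc a) (suc b) e → cong suc (inj a b e)))
      (⟦⟧-× (injective? g) (¬? (image? g i)))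
    outside : ∀ g → ∑ (allFin n) (λ i → ⟦ injective? g ⟧ ℕ.* ⟦ ¬? (image? g i) ⟧) ≡
                    ⟦ injective? g ⟧ ℕ.* (n ∸ k)
    outside g = trans (∑-*ˡ (allFin n) ⟦ injective? g ⟧ _) (⟦⟧-*-cong (injective? g) (∑-outside g))
    extend : ∑ (functions (suc k)) (λ g → ⟦ injective? g ⟧) ≡
             ∑ (functions k) (λ g → ⟦ injective? g ⟧) ℕ.* (n ∸ k)
    extend = begin
      ∑ (functions (suc k)) (λ g → ⟦ injective? g ⟧)
        ≡⟨ ∑-cartesianProductWith (Fin.∀-cons {P = λ _ → Fin n}) (allFin n) (functions k) _ ⟩
      ∑ (allFin n) (λ i → ∑ (functions k) (λ g → ⟦ injective? (Fin.∀-cons {P = λ _ → Fin n} i g) ⟧))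
        ≡⟨ ∑-swap (allFin n) (functions k) _ ⟩
      ∑ (functions k) (λ g → ∑ (allFin n) (λ i → ⟦ injective? (Fin.∀-cons {P = λ _ → Fin n} i g) ⟧))
        ≡⟨ ∑-cong (functions k) (λ g → trans (∑-cong (allFin n) (λ i → cons i g)) (outside g)) ⟩
      ∑ (functions k) (λ g → ⟦ injective? g ⟧ ℕ.* (n ∸ k))
        ≡⟨ ∑-*ʳ (functions k) (n ∸ k) _ ⟩
      ∑ (functions k) (λ g → ⟦ injective? g ⟧) ℕ.* (n ∸ k) ∎

injective⇒surjective : ∀ {n} (g : Fin n → Fin n) → (∀ i j → g i ≡ g j → i ≡ j) → ∀ i → ∃ λ j → g j ≡ i
injective⇒surjective {suc n} g inj i with Fin.any? (λ j → g j Fin.≟ i)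
... | yes hit = hit
... | no miss = contradiction
  (Fin.injective⇒≤ {f = λ j → punchOut (i≢ j)} (inj _ _ ∘ Fin.punchOut-injective (i≢ _) (i≢ _)))
  ℕ.1+n≰n
  where
  i≢ : ∀ j → i ≢ g j
  i≢ j e = miss (j , sym e)

∑-mapMaybe : (h : A → Maybe B) (xs : List A) (f : B → ℕ) →
             ∑ (mapMaybe h xs) f ≡ ∑ xs (λ x → maybe′ f 0 (h x))
∑-mapMaybe h []       f = refl
∑-mapMaybe h (x ∷ xs) f with h x
... | just y  = cong (f y ℕ.+_) (∑-mapMaybe h xs f)
... | nothing = ∑-mapMaybe h xs f

module _ {n : ℕ} {p : Partition n} where

  open Termination {n} {p}

  _≗?_ : (S T : Filling p) → Dec (S ≗ T)
  S ≗? T = allCells? λ x → S x Fin.≟ T x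

  fillings-once : (S : Filling p) → ∑ (fillings p) (λ T → ⟦ T ≗? S ⟧) ≡ 1
  fillings-once S = begin
    ∑ (fillings p) (λ T → ⟦ T ≗? S ⟧)
      ≡⟨ ∑-map (λ f x → f (rowᶠ x) (colᶠ x)) rowwise (λ T → ⟦ T ≗? S ⟧) ⟩
    ∑ rowwise (λ f → ⟦ (λ x → f (rowᶠ x) (colᶠ x)) ≗? S ⟧)
      ≡⟨ ∑-cong rowwise (λ f → ⟦⟧-cong ((λ x → f (rowᶠ x) (colᶠ x)) ≗? S)
           (Fin.all? λ i → Fin.all? λ j → f i j Fin.≟ S ⟨ i , j ⟩)
           (λ e i j → e ⟨ i , j ⟩) (λ e x → e (rowᶠ x) (colᶠ x))) ⟩
    ∑ rowwise (λ f → ⟦ Fin.all? (λ i → Fin.all? λ j → f i j Fin.≟ S ⟨ i , j ⟩) ⟧)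
      ≡⟨ choices-once (λ i g → Fin.all? λ j → g j Fin.≟ S ⟨ i , j ⟩) (λ i → choices λ j → allFin n) (λ i →
         choices-once (λ j k → k Fin.≟ S ⟨ i , j ⟩) (λ j → allFin n) (λ j →
         ∑-allFin-≡ (S ⟨ i , j ⟩) (Fin._≟ S ⟨ i , j ⟩) refl id)) ⟩
    1 ∎
    where
    open ≡-Reasoning
    rowwise : List (∀ i → Fin (lookup (parts p) i) → Fin n)
    rowwise = choices λ i → choices λ j → allFin n

  isTableau-resp : {S T : Filling p} → S ≗ T → IsTableau S → IsTableau T
  isTableau-resp S≗T (inj , sur) =
    (λ {x} {y} e → inj (trans (S≗T x) (trans e (sym (S≗T y))))) ,
    λ k → proj₁ (sur k) , λ { refl → trans (sym (S≗T _)) (proj₂ (sur k) refl) }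

  -- The list of tableaux contains every tableau exactly once, up to pointwise equality.  The
  -- proposition D may be any reformulation of that equality.
  tableaux-once : (S : Filling p) → IsTableau S → {D : Tableau p → Set} (D? : Decidable D) →
                  (∀ T → D T → proj₁ T ≗ S) → (∀ T → proj₁ T ≗ S → D T) →
                  ∑ (tableaux p) (λ T → ⟦ D? T ⟧) ≡ 1
  tableaux-once S S-tab D? to from =
    trans (∑-mapMaybe _ (fillings p) _) (trans (∑-cong (fillings p) term) (fillings-once S))
    where
    term : ∀ T → maybe′ (λ T → ⟦ D? T ⟧) 0 (Maybe.map (T ,_) (dec⇒maybe (isTableau? T))) ≡ ⟦ T ≗? S ⟧
    term T with isTableau? T
    ... | yes T-tab = ⟦⟧-cong (D? (T , T-tab)) (T ≗? S) (to _) (from _)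
    ... | no ¬T-tab = sym (⟦⟧-false (T ≗? S) λ T≗S → ¬T-tab (isTableau-resp (sym ∘ T≗S) S-tab))

  transpose-tableau : ∀ i j {T : Filling p} → IsTableau T → IsTableau (transpose i j ∘ T)
  transpose-tableau i j {T} (inj , sur) =
    (λ e → inj (trans (sym (transpose-inverse j i))
                      (trans (cong (transpose j i) e) (transpose-inverse j i)))) ,
    λ k → proj₁ (sur (transpose j i k)) ,
          λ { refl → trans (cong (transpose i j) (proj₂ (sur _) refl)) (transpose-inverse i j) }

  -- Transposing the entries i and j permutes the tableaux.
  ∑-transpose : ∀ i j (f g : Tableau p → ℕ) →
    (∀ S T → proj₁ T ≗ transpose i j ∘ proj₁ S → f S ≡ g T) → ∑ (tableaux p) f ≡ ∑ (tableaux p) g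
  ∑-transpose i j f g = λ e → ∑-correspondence (λ S T → proj₁ T ≗? (transpose i j ∘ proj₁ S))
    (tableaux p) (tableaux p)
    (λ (S , S-tab) → tableaux-once _ (transpose-tableau i j S-tab)
       (λ T → proj₁ T ≗? (transpose i j ∘ S)) (λ _ → id) (λ _ → id))
    (λ (T , T-tab) → tableaux-once _ (transpose-tableau j i T-tab)
       (λ S → T ≗? (transpose i j ∘ proj₁ S))
       (λ (S , _) e x → trans (sym (transpose-inverse j i {S x})) (cong (transpose j i) (sym (e x))))
       (λ (S , _) e x → trans (sym (transpose-inverse i j {T x})) (cong (transpose i j) (sym (e x)))))
    (λ {S} {T} → e S T)

  -- Reading a tableau in the order of U gives a bijection between tableaux and injections from
  -- Fin n to itself.
  length-tableaux : SYT p → length (tableaux p) ≡ n !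
  length-tableaux U = begin
    length (tableaux p)            ≡⟨ ℕ.*-identityʳ _ ⟨
    length (tableaux p) ℕ.* 1      ≡⟨ ∑-const (tableaux p) 1 ⟨
    ∑ (tableaux p) (λ _ → 1)
      ≡⟨ ∑-cong (tableaux p) (λ (T , _) → choices-once (λ i k → k Fin.≟ T (u⁻¹ U i)) (λ _ → allFin n) (λ i →
           ∑-allFin-≡ (T (u⁻¹ U i)) (Fin._≟ T (u⁻¹ U i)) refl id)) ⟨
    ∑ (tableaux p) (λ (T , _) → ∑ (functions {n} n) (λ g → ⟦ Fin.all? (λ i → g i Fin.≟ T (u⁻¹ U i)) ⟧))
      ≡⟨ ∑-swap (tableaux p) (functions {n} n) _ ⟩
    ∑ (functions {n} n) (λ g → ∑ (tableaux p) (λ (T , _) → ⟦ Fin.all? (λ i → g i Fin.≟ T (u⁻¹ U i)) ⟧))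
      ≡⟨ ∑-cong (functions {n} n) readings ⟩
    count                          ≡⟨ ℕ.*-identityʳ count ⟨
    count ℕ.* 0 !                  ≡⟨ cong (λ k → count ℕ.* k !) (ℕ.n∸n≡0 n) ⟨
    count ℕ.* (n ∸ n) !            ≡⟨ injections {n} n ℕ.≤-refl ⟩
    n ! ∎
    where
    open ≡-Reasoning
    u = proj₁ U
    u-inj = proj₁ (proj₁ (proj₂ U))
    count = ∑ (functions {n} n) (λ g → ⟦ injective? g ⟧)
    readings : ∀ g → ∑ (tableaux p) (λ (T , _) → ⟦ Fin.all? (λ i → g i Fin.≟ T (u⁻¹ U i)) ⟧) ≡
                     ⟦ injective? g ⟧
    readings g = ⟦⟧-intro (injective? g)
      (λ inj → tableaux-once (g ∘ u)
      ( (λ e → u-inj (inj _ _ e))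
      , λ k → let i , e = injective⇒surjective g inj k in
              u⁻¹ U i , λ { refl → trans (cong g (u-u⁻¹ U i)) e })
      (λ (T , _) → Fin.all? λ i → g i Fin.≟ T (u⁻¹ U i))
        (λ (T , _) e x → trans (cong T (sym (u⁻¹-u U x))) (sym (e (u x))))
        (λ (T , _) e i → sym (trans (e (u⁻¹ U i)) (cong g (u-u⁻¹ U i)))))
      λ ¬inj → ∑-zero (tableaux p) λ (T , T-inj , _) →
        ⟦⟧-false (Fin.all? λ i → g i Fin.≟ T (u⁻¹ U i)) λ e →
      ¬inj λ i j gi≡gj → trans (sym (u-u⁻¹ U i)) (trans
        (cong u (T-inj (trans (sym (e i)) (trans gi≡gj (e j))))) (u-u⁻¹ U j))

  -- By symmetry each of the n entries is equally often at x, and there are n! tableaux.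
  count-entry : SYT p → (x : Cell p) (k : Fin n) →
                ∑ (tableaux p) (λ (T , _) → ⟦ T x Fin.≟ k ⟧) ≡ (n ∸ 1) !
  count-entry U x k = cancel n (proj₁ U x) (begin
    n ℕ.* c k ≡⟨ cong (ℕ._* c k) (length-allFin n) ⟨
    length (allFin n) ℕ.* c k ≡⟨ ∑-const (allFin n) (c k) ⟨
    ∑ (allFin n) (λ _ → c k)
      ≡⟨ ∑-cong (allFin n) (λ j → ∑-transpose k j _ _ (swapped j)) ⟩
    ∑ (allFin n) (λ j → ∑ (tableaux p) (λ (T , _) → ⟦ T x Fin.≟ j ⟧))
      ≡⟨ ∑-swap (allFin n) (tableaux p) _ ⟩
    ∑ (tableaux p) (λ (T , _) → ∑ (allFin n) (λ j → ⟦ T x Fin.≟ j ⟧))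
      ≡⟨ ∑-cong (tableaux p) (λ (T , _) → ∑-allFin-≡ (T x) (T x Fin.≟_) refl sym) ⟩
    ∑ (tableaux p) (λ _ → 1) ≡⟨ ∑-const (tableaux p) 1 ⟩
    length (tableaux p) ℕ.* 1 ≡⟨ ℕ.*-identityʳ _ ⟩
    length (tableaux p) ≡⟨ length-tableaux U ⟩
    n ! ∎)
    where
    open ≡-Reasoning
    c : Fin n → ℕ
    c k = ∑ (tableaux p) (λ (T , _) → ⟦ T x Fin.≟ k ⟧)
    swapped : ∀ j S T → proj₁ T ≗ transpose k j ∘ proj₁ S →
              ⟦ proj₁ S x Fin.≟ k ⟧ ≡ ⟦ proj₁ T x Fin.≟ j ⟧
    swapped j (S , _) (T , _) e = ⟦⟧-cong (S x Fin.≟ k) (T x Fin.≟ j)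
      (λ Sx≡k → trans (e x) (trans (cong (transpose k j) Sx≡k) (transpose-left k j)))
      (λ Tx≡j → trans (sym (transpose-inverse j k))
                  (trans (cong (transpose j k) (trans (sym (e x)) Tx≡j)) (transpose-left j k)))
    cancel : ∀ n → Fin n → ∀ {c} → n ℕ.* c ≡ n ! → c ≡ (n ∸ 1) !
    cancel (suc n) _ e = ℕ.*-cancelˡ-≡ _ _ (suc n) e

-- Transpositions of consecutive entries

transpose-right : ∀ {n} (i j : Fin n) → transpose i j j ≡ i
transpose-right i j with j Fin.≟ i
... | yes j≡i = j≡i
... | no _ rewrite dec-true (j Fin.≟ j) refl = refl

transpose-other : ∀ {n} (i j : Fin n) {k} → k ≢ i → k ≢ j → transpose i j k ≡ k
transpose-other i j {k} k≢i k≢j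
  rewrite dec-false (k Fin.≟ i) k≢i | dec-false (k Fin.≟ j) k≢j = refl

-- The values i and j are consecutive, in either order.
Adjacent : ∀ {n} → Fin n → Fin n → Set
Adjacent i j = toℕ j ≡ suc (toℕ i) ⊎ toℕ i ≡ suc (toℕ j)

-- Only the relative order of i and j is affected, so the transposition is monotone away from i.
transpose-mono-≤ : ∀ {n} {i j : Fin n} → Adjacent i j → ∀ {k l} → k ≢ i → l ≢ i →
                   k Fin.≤ l → transpose i j k Fin.≤ transpose i j l
transpose-mono-≤ {i = i} {j} adj {k} {l} k≢i l≢i k≤l with k Fin.≟ j | l Fin.≟ j
... | yes refl | yes refl = ℕ.≤-refl
... | no k≢j | no l≢j rewrite transpose-other i j k≢i k≢j | transpose-other i j l≢i l≢j = k≤l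
... | yes refl | no l≢j rewrite transpose-right i k | transpose-other i k l≢i l≢j = i≤l adj
  where
  k<l = ℕ.≤∧≢⇒< k≤l (λ e → l≢j (Fin.toℕ-injective (sym e)))
  i≤l : Adjacent i k → i Fin.≤ l
  i≤l (inj₁ e) = ℕ.≤-trans (ℕ.n≤1+n _) (ℕ.≤-trans (ℕ.≤-reflexive (sym e)) k≤l)
  i≤l (inj₂ e) = ℕ.≤-trans (ℕ.≤-reflexive e) k<l
... | no k≢j | yes refl rewrite transpose-right i l | transpose-other i l k≢i k≢j = k≤i adj
  where
  k<l = ℕ.≤∧≢⇒< k≤l (λ e → k≢j (Fin.toℕ-injective e))
  k≤i : Adjacent i l → k Fin.≤ i
  k≤i (inj₁ e) = ℕ.≤-pred (ℕ.≤-trans k<l (ℕ.≤-reflexive e))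
  k≤i (inj₂ e) = ℕ.≤-trans k≤l (ℕ.≤-trans (ℕ.n≤1+n _) (ℕ.≤-reflexive (sym e)))

-- The invariant of the algorithm

module _ {n : ℕ} {p : Partition n} where

  -- Passing from T to T′ exchanges the entry a at x with the entry b at y.  This is the condition
  -- imposed on a single step in Exchanges.
  Swap : (T T′ : Filling p) (a b : ℕ) (x y : Cell p) → Set
  Swap T T′ a b x y = entry T x ≡ a × entry T y ≡ b × entry T′ x ≡ b × entry T′ y ≡ a

  swap? : (T T′ : Filling p) (a b : ℕ) (x y : Cell p) →
          Dec (Swap T T′ a b x y)
  swap? T T′ a b x y =
    entry T x ℕ.≟ a ×-dec entry T y ℕ.≟ b ×-dec entry T′ x ℕ.≟ b ×-dec entry T′ y ℕ.≟ a

module _ {n : ℕ} {p : Partition n} (U : SYT p) where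

  open Termination {n} {p}

  private
    u : Cell p → Fin n
    u = proj₁ U

  u-⋖ : ∀ {x y : Cell p} → x ⋖ y → u x Fin.< u y
  u-⋖ = standard-⋖ (proj₂ (proj₂ U))

  Inj : Filling p → Set
  Inj T = Injective _≡_ _≡_ T

  exchange-right : ∀ {x y} (T : Filling p) → x ≢ y → exchange x y T y ≡ T x
  exchange-right {x} {y} T x≢y with y ≟ x | y ≟ y
  ... | yes y≡x | _      = contradiction (sym y≡x) x≢y
  ... | no _    | yes _  = refl
  ... | no _    | no y≢y = contradiction refl y≢y

  module _ {T : Filling p} {x y : Cell p} (e : Exchangeable T x y) where
    open Exchangeable e

    exchangeable-⋖ : x ⋖ y
    exchangeable-⋖ = N⁺-⋖ neighbour

    exchangeable-right : exchange x y T y ≡ T x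
    exchangeable-right = exchange-right T (⋖⇒≢ exchangeable-⋖)

    minimal-< : Inj T → ∀ {z} → x ⋖ z → z ≢ y → T y Fin.< T z
    minimal-< inj x⋖z z≢y = ℕ.≤∧≢⇒< (minimal _ (∈N⁺ x⋖z)) (λ e → z≢y (sym (inj (Fin.toℕ-injective e))))

    -- In an exchange the larger entry is at the upper left cell x, the smaller one at y.
    exchanged : Inj T → ∀ {a b} → a < b → ∀ {z w} →
      Swap T (exchange x y T) a b z w → z ≡ y × w ≡ x
    exchanged inj a<b {z} {w} (Tz , Tw , T′z , T′w) with z ≟ x | z ≟ y
    ... | yes refl | _ = contradiction descent (ℕ.<-asym (ℕ.≤-pred (subst₂ _<_ (sym Tz) (sym T′z) a<b)))
    ... | no _ | yes refl = refl , inj (Fin.toℕ-injective (ℕ.suc-injective (trans Tw (sym T′z))))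
    ... | no _ | no _ = contradiction (trans (sym Tz) T′z) (ℕ.<⇒≢ a<b)

    exchanged⁻ : ∀ {a b} → entry T y ≡ a → entry T x ≡ b →
      Swap T (exchange x y T) a b y x
    exchanged⁻ refl refl =
      refl , refl , cong (suc ∘ toℕ) exchangeable-right , cong (suc ∘ toℕ) (exchange-left x y T)

  -- A phase of the algorithm starts at a cell with U-value k, and its entry slides down and is
  -- now at w.  The cells with U-value at least k are sorted, except that the entry at w may be
  -- larger than its lower and right neighbours; the entries above and to the left of w are
  -- smaller than those below and to the right of it.  The values of U are counted from 0.
  record Sliding (k : ℕ) (w : Cell p) (T : Filling p) : Set where
    field
      sorted : ∀ {s t} → s ⋖ t → k ≤ toℕ (u s) → s ≢ w → T s Fin.< T t
      across : ∀ {s t} → s ⋖ w → w ⋖ t → k ≤ toℕ (u s) → T s Fin.< T t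

  -- Before the first phase the level is n, which no cell reaches, and w is arbitrary.
  sliding-start : ∀ {w T} → Sliding n w T
  sliding-start = record
    { sorted = λ _ n≤us _ → contradiction (Fin.toℕ<n (u _)) (ℕ.≤⇒≯ n≤us)
    ; across = λ _ _ n≤us → contradiction (Fin.toℕ<n (u _)) (ℕ.≤⇒≯ n≤us)
    }

  sliding-step : ∀ {k x y T} → Inj T → Exchangeable T x y → k ≤ toℕ (u x) → Sliding k x T →
                 Sliding k y (exchange x y T)
  sliding-step {k} {x} {y} {T} inj e k≤ux sl = record { sorted = sorted′ ; across = across′ }
    where
    open Sliding sl
    open Exchangeable e
    x⋖y = exchangeable-⋖ e
    sorted′ : ∀ {s t} → s ⋖ t → k ≤ toℕ (u s) → s ≢ y → exchange x y T s Fin.< exchange x y T t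
    sorted′ {s} {t} s⋖t k≤us s≢y with s ≟ x | s ≟ y | t ≟ x | t ≟ y
    ... | _        | yes s≡y | _        | _        = contradiction s≡y s≢y
    ... | yes refl | no _    | yes refl | _        = contradiction refl (⋖⇒≢ s⋖t)
    ... | yes refl | no _    | no _     | yes refl = descent
    ... | yes refl | no _    | no _     | no t≢y   = minimal-< e inj s⋖t t≢y
    ... | no s≢x   | no _    | yes refl | _        = across s⋖t x⋖y k≤us
    ... | no s≢x   | no _    | no _     | yes refl = ℕ.<-trans (sorted s⋖t k≤us s≢x) descent
    ... | no s≢x   | no _    | no _     | no _     = sorted s⋖t k≤us s≢x
    across′ : ∀ {s t} → s ⋖ y → y ⋖ t → k ≤ toℕ (u s) → exchange x y T s Fin.< exchange x y T t
    across′ {s} {t} s⋖y y⋖t k≤us =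
      subst (exchange x y T s Fin.<_)
        (sym (exchange-other x y T t (λ { refl → ℕ.<-asym (u-⋖ x⋖y) (u-⋖ y⋖t) }) (⋖⇒≢ y⋖t ∘ sym))) below
      where
      y<t = sorted y⋖t (ℕ.≤-trans k≤us (ℕ.<⇒≤ (u-⋖ s⋖y))) (⋖⇒≢ x⋖y ∘ sym)
      below : exchange x y T s Fin.< T t
      below with s ≟ x | s ≟ y
      ... | yes _  | _        = y<t
      ... | no _   | yes refl = contradiction refl (⋖⇒≢ s⋖y)
      ... | no s≢x | no _     = ℕ.<-trans (sorted s⋖y k≤us s≢x) y<t

  -- By the choice of x, no cell after x in the order of U has a descent, so a phase can start at x.
  sliding-restart : ∀ {x y T} → Inj T → NextExchange U T x y → Sliding (toℕ (u x)) x T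
  sliding-restart {x} {y} {T} inj next = record
    { sorted = sorted′
    ; across = λ s⋖x _ ux≤us → contradiction (u-⋖ s⋖x) (ℕ.≤⇒≯ ux≤us)
    }
    where
    open NextExchange next
    sorted′ : ∀ {s t} → s ⋖ t → u x Fin.≤ u s → s ≢ x → T s Fin.< T t
    sorted′ {s} {t} s⋖t ux≤us s≢x with Fin.<-cmp (T s) (T t)
    ... | tri< lt _ _ = lt
    ... | tri≈ _ eq _ = contradiction (inj eq) (⋖⇒≢ s⋖t)
    ... | tri> _ _ gt = contradiction
      (proj₁ (proj₁ (proj₂ U)) (Fin.≤-antisym (maximal s _ (proj₂ ex)) ux≤us)) s≢x
      where ex = violation-exchangeable {T = T} (lose (∈N⁺ s⋖t) gt)

  -- The next exchange, at x, either continues the phase or starts a new one at a lower level.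
  data Phase (k : ℕ) (w x : Cell p) (T : Filling p) : Set where
    continue : x ≡ w → k ≤ toℕ (u x) → Sliding k x T → Phase k w x T
    restart  : toℕ (u x) < k → Sliding (toℕ (u x)) x T → Phase k w x T

  phase : ∀ {k w x y T} → Inj T → Sliding k w T → NextExchange U T x y → Phase k w x T
  phase {k} {w} {x} {y} {T} inj sl next with k ℕ.≤? toℕ (u x) | x ≟ w
  ... | yes k≤ux | yes refl = continue refl k≤ux sl
  ... | yes k≤ux | no x≢w   = contradiction (Sliding.sorted sl (exchangeable-⋖ exchangeable) k≤ux x≢w)
                                            (ℕ.<-asym (Exchangeable.descent exchangeable))
    where open NextExchange next
  ... | no k≰ux  | _        = restart (ℕ.≰⇒> k≰ux) (sliding-restart inj next)

  -- What is known about the entry b if an exchange with a smaller entry a, in which b leaves y,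
  -- is still to come.  Either b is at a cell z that no phase has reached, or b is the sliding
  -- entry.  In the latter case it has not yet passed y, and the entries above and to the left of
  -- it, at cells with U-value at least k, are smaller than a.  As b only moves down or right
  -- while it slides, U w ≤ U y records that y has not been passed.
  data Pending (k : ℕ) (w : Cell p) (T : Filling p) (a b : ℕ) (y : Cell p) : Set where
    waiting : ∀ z → entry T z ≡ b → toℕ (u z) < k → Pending k w T a b y
    sliding : entry T w ≡ b → u w Fin.≤ u y → (∀ {s} → s ⋖ w → k ≤ toℕ (u s) → entry T s < a) →
              Pending k w T a b y

  -- A run that exchanges a < b at x and y passes through pending states until it does so.
  pending : ∀ {k w T a b x y} → Inj T → Sliding k w T → (run : Run U T) → a < b →
            Exchanges a b x y run → Pending k w T a b y
  -- The state before an exchange of x and y, if the run after it still exchanges a < b.  In the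
  -- second case b is at x and slides past the entry of y, which is smaller than a.
  pending-after : ∀ {k x y T a b z w} → Inj T → k ≤ toℕ (u x) → Sliding k x T → NextExchange U T x y →
    (run : Run U (exchange x y T)) → a < b → Exchanges a b z w run →
    (∃ λ v → entry T v ≡ b × toℕ (u v) < k) ⊎ (entry T x ≡ b × u y Fin.≤ u w × entry T y < a)

  pending-after {k} {x} {y} {T} {a} inj k≤ux sl next run a<b ex
    with pending (exchange-injective x y inj) (sliding-step inj exchangeable k≤ux sl) run a<b ex
    where open NextExchange next
  ... | waiting v Tv uv<k = inj₁ (v , trans (cong (suc ∘ toℕ) (sym untouched)) Tv , uv<k)
    where
    open NextExchange next
    k≤uy = ℕ.≤-trans k≤ux (ℕ.<⇒≤ (u-⋖ (exchangeable-⋖ exchangeable)))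
    untouched : exchange x y T v ≡ T v
    untouched = exchange-other x y T v
      (λ { refl → ℕ.<⇒≱ uv<k k≤ux }) (λ { refl → ℕ.<⇒≱ uv<k k≤uy })
  ... | sliding Ty uy≤uw below = inj₂
    ( trans (cong (suc ∘ toℕ) (sym (exchangeable-right exchangeable))) Ty
    , uy≤uw
    , subst (_< a) (cong (suc ∘ toℕ) (exchange-left x y T)) (below (exchangeable-⋖ exchangeable) k≤ux) )
    where open NextExchange next

  pending inj sl (step {T} x y _ next run) a<b (inj₁ swap@(_ , Ty , _ , _))
    with exchanged (NextExchange.exchangeable next) inj a<b swap | phase inj sl next
  ... | refl , refl | restart ux<k _ = waiting x Ty ux<k
  pending {T = T} inj sl (step x y _ next run) a<b (inj₁ swap@(Tx , Ty , _ , _))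
      | refl , refl | continue refl k≤ux _ =
    sliding Ty ℕ.≤-refl λ {s} s⋖x k≤us →
      subst (entry T s <_) Tx
        (s≤s (Sliding.across sl s⋖x (exchangeable-⋖ (NextExchange.exchangeable next)) k≤us))
  pending inj sl (step x y _ next run) a<b (inj₂ later) with phase inj sl next
  pending {T = T} {a} inj sl (step x y _ next run) a<b (inj₂ later) | continue refl k≤ux sl′
    with pending-after inj k≤ux sl′ next run a<b later
  ... | inj₁ (v , Tv , uv<k) = waiting v Tv uv<k
  ... | inj₂ (Tx , uy≤uw , Ty<a) =
    sliding Tx (ℕ.≤-trans (ℕ.<⇒≤ (u-⋖ x⋖y)) uy≤uw) λ s⋖x k≤us →
      ℕ.<-trans (s≤s (Sliding.across sl s⋖x x⋖y k≤us)) Ty<a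
    where x⋖y = exchangeable-⋖ (NextExchange.exchangeable next)
  pending inj sl (step x y _ next run) a<b (inj₂ later) | restart ux<k sl′
    with pending-after inj ℕ.≤-refl sl′ next run a<b later
  ... | inj₁ (v , Tv , uv<ux) = waiting v Tv (ℕ.<-trans uv<ux ux<k)
  ... | inj₂ (Tx , _ , _)     = waiting x Tx ux<k

  phase-sliding : ∀ {k w x T} → Phase k w x T → ∃ λ k′ → k′ ≤ toℕ (u x) × Sliding k′ x T
  phase-sliding (continue _ k≤ux sl) = _ , k≤ux , sl
  phase-sliding (restart _ sl)       = _ , ℕ.≤-refl , sl

  -- After b has been exchanged with a it slides on below y, so it is neither waiting nor able to
  -- leave y a second time.
  exchanges-once : ∀ {k w T a b x y z₁ z₂} → Inj T → Sliding k w T → (next : NextExchange U T z₁ z₂) →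
    (run : Run U (exchange z₁ z₂ T)) → a < b →
    Swap T (exchange z₁ z₂ T) a b x y →
    ¬ Exchanges a b x y run
  exchanges-once inj sl next run a<b swap@(_ , Ty , _ , _) later
    with exchanged (NextExchange.exchangeable next) inj a<b swap | phase-sliding (phase inj sl next)
  ... | refl , refl | k′ , k′≤ux , sl′ with pending-after inj k′≤ux sl′ next run a<b later
  ...   | inj₁ (v , Tv , uv<k′) with inj (Fin.toℕ-injective (ℕ.suc-injective (trans Tv (sym Ty))))
  ...     | refl = ℕ.<⇒≱ uv<k′ k′≤ux
  exchanges-once inj sl next run a<b swap@(_ , Ty , _ , _) later
      | refl , refl | k′ , k′≤ux , sl′ | inj₂ (_ , uy≤ux , _) =
    ℕ.<⇒≱ (u-⋖ (exchangeable-⋖ (NextExchange.exchangeable next))) uy≤ux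

  -- Independence of the larger entry

  -- The next exchange is determined by the tableau.
  nextExchange-unique : ∀ {T x y x′ y′} → Inj T → NextExchange U T x y → NextExchange U T x′ y′ →
                        x ≡ x′ × y ≡ y′
  nextExchange-unique inj next next′
    with proj₁ (proj₁ (proj₂ U)) (Fin.≤-antisym (maximal next′ _ _ (exchangeable next))
                                                (maximal next _ _ (exchangeable next′)))
    where open NextExchange
  ... | refl = refl , inj (Fin.≤-antisym (minimal e _ (neighbour e′)) (minimal e′ _ (neighbour e)))
    where
    open Exchangeable
    e  = NextExchange.exchangeable next
    e′ = NextExchange.exchangeable next′

  -- Every run from T begins with the given next exchange.
  run-next : ∀ {T x y} → Inj T → NextExchange U T x y → (run : Run U T) →
    Σ (Run U (exchange x y T)) λ rest → ∀ {a b z w} →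
      Swap T (exchange x y T) a b z w ⊎ Exchanges a b z w rest → Exchanges a b z w run
  run-next inj next (stop st) = contradiction (standard-⋖ st (exchangeable-⋖ exchangeable))
                                              (ℕ.<-asym (Exchangeable.descent exchangeable))
    where open NextExchange next
  run-next inj next (step x y _ next′ run) with nextExchange-unique inj next next′
  ... | refl , refl = run , id

  exchange-∘ : ∀ (σ : Fin n → Fin n) x y {S T : Filling p} →
               T ≗ σ ∘ S → exchange x y T ≗ σ ∘ exchange x y S
  exchange-∘ σ x y e z with z ≟ x | z ≟ y
  ... | yes _ | _     = e y
  ... | no _  | yes _ = e x
  ... | no _  | no _  = e z

  module _ {i j : Fin n} (adj : Adjacent i j) where

    -- The transposition of i and j leaves the next exchange unchanged, if the entry i is at a cell z
    -- that is x or precedes x in the order of U, and if i, when it slides, passes an entry that is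
    -- smaller than both i and j.  Every comparison at x or at a later cell then avoids i, except the
    -- one between x and y when z = x.
    nextExchange-transpose : ∀ {S T x y z} → Inj T → T ≗ transpose i j ∘ S →
      S z ≡ i → u z Fin.≤ u x → (z ≡ x → S y Fin.< i × S y Fin.< j) → Inj S →
      NextExchange U S x y → NextExchange U T x y
    nextExchange-transpose {S} {T} {x} {y} {z} T-inj T≗σS Sz≡i uz≤ux small S-inj next = record
      { exchangeable = record
        { neighbour = neighbour
        ; minimal   = λ w w∈ → mono (beyond ux<uy) (beyond (u-⋖ (N⁺-⋖ w∈))) (minimal w w∈)
        ; descent   = descent′
        }
      ; maximal      = maximal′
      }
      where
      open NextExchange next
      open Exchangeable exchangeable
      ux<uy = u-⋖ (exchangeable-⋖ exchangeable)
      away : ∀ {w} → w ≢ z → S w ≢ i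
      away w≢z Sw≡i = w≢z (S-inj (trans Sw≡i (sym Sz≡i)))
      beyond : ∀ {w} → u x Fin.< u w → S w ≢ i
      beyond ux<uw = away λ { refl → ℕ.<⇒≱ ux<uw uz≤ux }
      mono : ∀ {v w} → S v ≢ i → S w ≢ i → S v Fin.≤ S w → T v Fin.≤ T w
      mono {v} {w} Sv≢i Sw≢i rewrite T≗σS v | T≗σS w = transpose-mono-≤ adj Sv≢i Sw≢i
      descent′ : T y Fin.< T x
      descent′ with x ≟ z
      ... | yes refl rewrite T≗σS y | T≗σS x | Sz≡i | transpose-left i j
        | transpose-other i j (Fin.<⇒≢ (proj₁ (small refl))) (Fin.<⇒≢ (proj₂ (small refl)))
        = proj₂ (small refl)
      ... | no x≢z = ℕ.≤∧≢⇒< (mono (beyond ux<uy) (away x≢z) (ℕ.<⇒≤ descent))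
                             (λ e → ⋖⇒≢ (exchangeable-⋖ exchangeable) (sym (T-inj (Fin.toℕ-injective e))))
      maximal′ : ∀ x′ y′ → Exchangeable T x′ y′ → u x′ Fin.≤ u x
      maximal′ x′ y′ e = ℕ.≮⇒≥ λ ux<ux′ →
        let x′⋖y′ = exchangeable-⋖ e in
        case ℕ.<-≤-connex (toℕ (S y′)) (toℕ (S x′)) of λ where
          (inj₁ lt) → ℕ.<⇒≱ ux<ux′
                        (maximal x′ _ (proj₂ (violation-exchangeable {T = S} (lose (∈N⁺ x′⋖y′) lt))))
          (inj₂ ge) → ℕ.<⇒≱ (Exchangeable.descent e)
                        (mono (beyond ux<ux′) (beyond (ℕ.<-trans ux<ux′ (u-⋖ x′⋖y′))) ge)

    -- Let a be smaller than the entries of the consecutive values i and j.  If the run from S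
    -- exchanges a with i, then the run from S with i and j transposed exchanges a with j at the
    -- same cells.
    exchanges-transpose : ∀ {k w S T a x y} → Inj S → Inj T → T ≗ transpose i j ∘ S → Sliding k w S →
      a < suc (toℕ i) → a < suc (toℕ j) → (run : Run U S) (run′ : Run U T) →
      Exchanges a (suc (toℕ i)) x y run → Exchanges a (suc (toℕ j)) x y run′
    exchanges-transpose {S = S} {T} {a} S-inj T-inj T≗σS sl a<i a<j (step x y _ next run) run′
      (inj₁ swap@(Sy , Sx , _ , _))
      with exchanged (NextExchange.exchangeable next) S-inj a<i swap
    ... | refl , refl = proj₂ (run-next T-inj next′ run′)
      (inj₁ (exchanged⁻ (NextExchange.exchangeable next′) Ty Tx))
      where
      Sx≡i : S x ≡ i
      Sx≡i = Fin.toℕ-injective (ℕ.suc-injective Sx)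
      Sy<i : S y Fin.< i
      Sy<i = ℕ.≤-pred (subst (_< suc (toℕ i)) (sym Sy) a<i)
      Sy<j : S y Fin.< j
      Sy<j = ℕ.≤-pred (subst (_< suc (toℕ j)) (sym Sy) a<j)
      next′ = nextExchange-transpose T-inj T≗σS Sx≡i ℕ.≤-refl (λ _ → Sy<i , Sy<j) S-inj next
      Ty : entry T y ≡ a
      Ty = trans (cong (suc ∘ toℕ) (trans (T≗σS y) (transpose-other i j (Fin.<⇒≢ Sy<i) (Fin.<⇒≢ Sy<j)))) Sy
      Tx : entry T x ≡ suc (toℕ j)
      Tx = cong (suc ∘ toℕ) (trans (T≗σS x) (trans (cong (transpose i j) Sx≡i) (transpose-left i j)))
    exchanges-transpose {S = S} {T} {a} S-inj T-inj T≗σS sl a<i a<j (step x y _ next run) run′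
      (inj₂ later)
      with phase-sliding (phase S-inj sl next)
    ... | k′ , k′≤ux , sl′ = proj₂ (run-next T-inj next′ run′) (inj₂
      (exchanges-transpose (exchange-injective x y S-inj) (exchange-injective x y T-inj)
        (exchange-∘ (transpose i j) x y T≗σS)
        (sliding-step S-inj (NextExchange.exchangeable next) k′≤ux sl′)
        a<i a<j run (proj₁ (run-next T-inj next′ run′)) later))
      where
      next′ : NextExchange U T x y
      next′ with pending-after S-inj k′≤ux sl′ next run a<i later
      ... | inj₁ (v , Sv , uv<k′) =
        nextExchange-transpose T-inj T≗σS (Fin.toℕ-injective (ℕ.suc-injective Sv))
          (ℕ.≤-trans (ℕ.<⇒≤ uv<k′) k′≤ux) (λ { refl → contradiction k′≤ux (ℕ.<⇒≱ uv<k′) }) S-inj next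
      ... | inj₂ (Sx , _ , Sy<a) =
        nextExchange-transpose T-inj T≗σS (Fin.toℕ-injective (ℕ.suc-injective Sx)) ℕ.≤-refl
          (λ _ → ℕ.≤-pred (ℕ.<-trans Sy<a a<i) , ℕ.≤-pred (ℕ.<-trans Sy<a a<j)) S-inj next

  exchangeNumber-suc : ∀ {a b} (x y : Cell p) → a < b → suc b ≤ n →
                       exchangeNumber U a b x y ≡ exchangeNumber U a (suc b) x y
  exchangeNumber-suc {a} {suc b} x y a<b b<n = begin
    exchangeNumber U a (suc b) x y
      ≡⟨ length-filter-∑ _ (tableaux p) ⟩
    ∑ (tableaux p) (λ T → ⟦ exchanges? a (suc b) x y (run U T) ⟧)
      ≡⟨ ∑-transpose i j _ _ agree ⟩
    ∑ (tableaux p) (λ T → ⟦ exchanges? a (suc (suc b)) x y (run U T) ⟧)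
      ≡⟨ length-filter-∑ _ (tableaux p) ⟨
    exchangeNumber U a (suc (suc b)) x y ∎
    where
    open ≡-Reasoning
    i = fromℕ< (ℕ.<⇒≤ b<n)
    j = fromℕ< b<n
    i≡ : suc (toℕ i) ≡ suc b
    i≡ = cong suc (Fin.toℕ-fromℕ< _)
    j≡ : suc (toℕ j) ≡ suc (suc b)
    j≡ = cong suc (Fin.toℕ-fromℕ< _)
    a<i = subst (a <_) (sym i≡) a<b
    a<j = subst (a <_) (sym j≡) (ℕ.m<n⇒m<1+n a<b)
    i~j : toℕ j ≡ suc (toℕ i)
    i~j = trans (ℕ.suc-injective j≡) (sym i≡)
    agree : ∀ S T → proj₁ T ≗ transpose i j ∘ proj₁ S →
            ⟦ exchanges? a (suc b) x y (run U S) ⟧ ≡ ⟦ exchanges? a (suc (suc b)) x y (run U T) ⟧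
    agree S@(S₁ , S-inj , _) T@(T₁ , T-inj , _) T≗σS = ⟦⟧-cong
      (exchanges? a (suc b) x y (run U S)) (exchanges? a (suc (suc b)) x y (run U T))
      (λ ex → subst (λ b → Exchanges a b x y (run U T)) j≡
        (exchanges-transpose (inj₁ i~j) S-inj T-inj T≗σS (sliding-start {x}) a<i a<j (run U S) (run U T)
          (subst (λ b → Exchanges a b x y (run U S)) (sym i≡) ex)))
      -- The converse is the same statement with the roles of i and j interchanged.
      (λ ex → subst (λ b → Exchanges a b x y (run U S)) i≡
        (exchanges-transpose (inj₂ i~j) T-inj S-inj
          (λ z → trans (sym (transpose-inverse j i)) (cong (transpose j i) (sym (T≗σS z))))
          (sliding-start {x}) a<j a<i (run U T) (run U S)
          (subst (λ b → Exchanges a b x y (run U T)) (sym j≡) ex)))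

  -- The exchange number of a < b at x and y does not depend on b.
  exchangeNumber-≡-m : ∀ {a b} (x y : Cell p) → a < b → b ≤ n → exchangeNumber U a b x y ≡ m U a x y
  exchangeNumber-≡-m {a} {suc b} x y a<b b≤n with ℕ.m≤n⇒m<n∨m≡n (ℕ.≤-pred a<b)
  ... | inj₁ a<b′ =
    trans (sym (exchangeNumber-suc x y a<b′ b≤n)) (exchangeNumber-≡-m x y a<b′ (ℕ.<⇒≤ b≤n))
  ... | inj₂ refl = refl

-- Balance of an entry at a cell

∑∑-+ : (xs : List A) (ys : List B) {f g h : A → B → ℕ} →
       (∀ {x} → x ∈ xs → ∀ y → f x y ≡ g x y ℕ.+ h x y) →
       ∑ xs (λ x → ∑ ys (f x)) ≡ ∑ xs (λ x → ∑ ys (g x)) ℕ.+ ∑ xs (λ x → ∑ ys (h x))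
∑∑-+ xs ys e = trans (∑-cong-∈ λ x∈ → trans (∑-cong ys (e x∈)) (∑-+ ys _ _)) (∑-+ xs _ _)

∑∑-swap : (zs : List C) (xs : List A) (ys : List B) (f : C → A → B → ℕ) →
          ∑ zs (λ z → ∑ xs (λ x → ∑ ys (f z x))) ≡ ∑ xs (λ x → ∑ ys (λ y → ∑ zs (λ z → f z x y)))
∑∑-swap zs xs ys f = trans (∑-swap zs xs _) (∑-cong xs λ x → ∑-swap zs ys _)

sumℤ-∑ : (f g : A → ℕ) (xs : List A) → sumℤ (map (λ x → + f x - + g x) xs) ≡ + ∑ xs f - + ∑ xs g
sumℤ-∑ f g []       = refl
sumℤ-∑ f g (x ∷ xs) rewrite sumℤ-∑ f g xs | ℤ.pos-+ (f x) (∑ xs f) | ℤ.pos-+ (g x) (∑ xs g) =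
  ℤS.solve 4 (λ a b c d → (a ℤS.:- b) ℤS.:+ (c ℤS.:- d) ℤS.:=
                         (a ℤS.:+ c) ℤS.:- (b ℤS.:+ d))
             refl (+ f x) (+ g x) (+ ∑ xs f) (+ ∑ xs g)

-- The entries from 1 to b - 1, listed as in the theorem.
below : ℕ → List ℕ
below b = applyUpTo suc (b ∸ 1)

-- The entries from b + 1 to n.
above-to : ℕ → ℕ → List ℕ
above-to n b = applyUpTo (λ i → suc b ℕ.+ i) (n ∸ b)

below-< : ∀ {b c} → c ∈ below b → c < b
below-< {suc b} c∈ with ∈-applyUpTo⁻ suc c∈
... | i , i<b , refl = s≤s i<b
below-< {zero} ()

∈-below : ∀ {b i} → suc i < b → suc i ∈ below b
∈-below (s≤s i<b) = ∈-applyUpTo⁺ suc i<b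

below-! : ∀ b → Unique (below b)
below-! b = Unique.applyUpTo⁺₁ suc (b ∸ 1) λ i<j _ → ℕ.<⇒≢ (s≤s i<j)

above-> : ∀ {n b c} → c ∈ above-to n b → b < c
above-> {n} {b} c∈ with ∈-applyUpTo⁻ (λ i → suc b ℕ.+ i) c∈
... | i , _ , refl = ℕ.m≤m+n (suc b) i

above-≤ : ∀ {n b c} → b ≤ n → c ∈ above-to n b → c ≤ n
above-≤ {n} {b} b≤n c∈ with ∈-applyUpTo⁻ (λ i → suc b ℕ.+ i) c∈
... | i , i<n∸b , refl = subst (b ℕ.+ i <_) (ℕ.m+[n∸m]≡n b≤n) (ℕ.+-monoʳ-< b i<n∸b)

∈-above : ∀ {n b c} → b < c → c ≤ n → c ∈ above-to n b
∈-above {n} {b} (s≤s {n = c} b≤c) c<n = subst (_∈ above-to n b) (cong suc (ℕ.m+[n∸m]≡n b≤c))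
  (∈-applyUpTo⁺ (λ i → suc b ℕ.+ i)
    (subst (_≤ n ∸ b) (ℕ.+-∸-assoc 1 b≤c) (ℕ.∸-monoˡ-≤ b c<n)))

above-! : ∀ n b → Unique (above-to n b)
above-! n b = Unique.applyUpTo⁺₁ _ (n ∸ b) λ i<j _ → ℕ.<⇒≢ (ℕ.+-monoʳ-< (suc b) i<j)

∑-above : ∀ {n b k} {f : ℕ → ℕ} → (∀ {c} → c ∈ above-to n b → f c ≡ k) →
          ∑ (above-to n b) f ≡ (n ∸ b) ℕ.* k
∑-above {n} {b} {k} e = trans (∑-cong-∈ e)
  (trans (∑-const (above-to n b) k) (cong (ℕ._* k) (length-applyUpTo _ (n ∸ b))))

module _ {n : ℕ} {p : Partition n} where

  open Termination {n} {p}

  cells-! : Unique (cells {p = p})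
  cells-! = Unique.concat⁺
    (All.map⁺ (All.tabulate λ {i} _ → Unique.map⁺ (λ { refl → refl }) (Unique.allFin⁺ _)))
    (AllPairs.map⁺ (AllPairs.map disjoint (Unique.allFin⁺ _)))
    where
    row-≡ : ∀ i {x} → x ∈ map ⟨ i ,_⟩ (allFin _) → rowᶠ x ≡ i
    row-≡ i x∈ = cong rowᶠ (proj₂ (proj₂ (∈-map⁻ ⟨ i ,_⟩ x∈)))
    disjoint : ∀ {i j} → i ≢ j → ∀ {x} → ¬ (x ∈ map ⟨ i ,_⟩ (allFin _) × x ∈ map ⟨ j ,_⟩ (allFin _))
    disjoint {i} {j} i≢j (x∈i , x∈j) = i≢j (trans (sym (row-≡ i x∈i)) (row-≡ j x∈j))

  N⁺-! : (x : Cell p) → Unique (N⁺ x)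
  N⁺-! x = Unique.filter⁺ (x ⋖?_) cells-!

  N⁻-! : (x : Cell p) → Unique (N⁻ x)
  N⁻-! x = Unique.filter⁺ (_⋖? x) cells-!

  ∈N⁻ : ∀ {x y : Cell p} → x ⋖ y → x ∈ N⁻ y
  ∈N⁻ {y = y} = ∈-filter⁺ (_⋖? y) (∈-cells _)

  -- Let f a b x y, for a < b, count the exchanges of a at x with b at y.  Then gains f b x counts
  -- the moves of b into x: from above or from the left in an exchange with some c < b, from below
  -- or from the right in one with some c > b.  Similarly, losses f b x counts the moves of b out of x.
  gains losses : (ℕ → ℕ → Cell p → Cell p → ℕ) → ℕ → Cell p → ℕ
  gains  f b x = ∑ (below b) (λ c → ∑ (N⁻ x) (λ y → f c b x y)) ℕ.+
                 ∑ (above-to n b) (λ c → ∑ (N⁺ x) (λ y → f b c y x))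
  losses f b x = ∑ (below b) (λ c → ∑ (N⁺ x) (λ y → f c b y x)) ℕ.+
                 ∑ (above-to n b) (λ c → ∑ (N⁻ x) (λ y → f b c x y))

  module _ {f g h : ℕ → ℕ → Cell p → Cell p → ℕ}
           (e : ∀ {a b} x y → a < b → f a b x y ≡ g a b x y ℕ.+ h a b x y) (b : ℕ) (x : Cell p) where

    private
      interchange : ∀ a b c d → (a ℕ.+ b) ℕ.+ (c ℕ.+ d) ≡ (a ℕ.+ c) ℕ.+ (b ℕ.+ d)
      interchange = solve 4 (λ a b c d → (a :+ b) :+ (c :+ d) := (a :+ c) :+ (b :+ d)) refl

    gains-+ : gains f b x ≡ gains g b x ℕ.+ gains h b x
    gains-+ = trans
      (cong₂ ℕ._+_ (∑∑-+ (below b) (N⁻ x) λ c∈ y → e x y (below-< c∈))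
                   (∑∑-+ (above-to n b) (N⁺ x) λ c∈ y → e y x (above-> {n} c∈)))
      (interchange (∑ (below b) λ c → ∑ (N⁻ x) λ y → g c b x y)
                   (∑ (below b) λ c → ∑ (N⁻ x) λ y → h c b x y) _ _)

    losses-+ : losses f b x ≡ losses g b x ℕ.+ losses h b x
    losses-+ = trans
      (cong₂ ℕ._+_ (∑∑-+ (below b) (N⁺ x) λ c∈ y → e y x (below-< c∈))
                   (∑∑-+ (above-to n b) (N⁻ x) λ c∈ y → e x y (above-> {n} c∈)))
      (interchange (∑ (below b) λ c → ∑ (N⁺ x) λ y → g c b y x)
                   (∑ (below b) λ c → ∑ (N⁺ x) λ y → h c b y x) _ _)

  ∑-gains : (xs : List A) (f : A → ℕ → ℕ → Cell p → Cell p → ℕ) (b : ℕ) (x : Cell p) →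
    ∑ xs (λ t → gains (f t) b x) ≡ gains (λ a b x y → ∑ xs (λ t → f t a b x y)) b x
  ∑-gains xs f b x = trans (∑-+ xs _ _) (cong₂ ℕ._+_ (∑∑-swap xs (below b) (N⁻ x) _)
                                                     (∑∑-swap xs (above-to n b) (N⁺ x) _))

  ∑-losses : (xs : List A) (f : A → ℕ → ℕ → Cell p → Cell p → ℕ) (b : ℕ) (x : Cell p) →
    ∑ xs (λ t → losses (f t) b x) ≡ losses (λ a b x y → ∑ xs (λ t → f t a b x y)) b x
  ∑-losses xs f b x = trans (∑-+ xs _ _) (cong₂ ℕ._+_ (∑∑-swap xs (below b) (N⁺ x) _)
                                                      (∑∑-swap xs (above-to n b) (N⁻ x) _))

module _ {n : ℕ} {p : Partition n} (U : SYT p) where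

  open Termination {n} {p}

  -- One exchange of v and w changes [T x = b] by its gain minus its loss.  Each of the four sums has
  -- at most one non-zero term, in which the other entry and the other cell are those of the
  -- exchange.
  balance-step : ∀ {T : Filling p} {v w} → Injective _≡_ _≡_ T → Exchangeable T v w → ∀ b x →
    ⟦ entry T x ℕ.≟ b ⟧ ℕ.+ gains (λ a b y z → ⟦ swap? T (exchange v w T) a b y z ⟧) b x ≡
    ⟦ entry (exchange v w T) x ℕ.≟ b ⟧ ℕ.+ losses (λ a b y z → ⟦ swap? T (exchange v w T) a b y z ⟧) b x
  balance-step {T} {v} {w} inj e b x = begin
    ⟦ entry T x ℕ.≟ b ⟧ ℕ.+ gains f b x
      ≡⟨ cong (⟦ entry T x ℕ.≟ b ⟧ ℕ.+_) (cong₂ ℕ._+_ moved-down moved-up) ⟩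
    ⟦ entry T x ℕ.≟ b ⟧ ℕ.+ (⟦ larger ×-dec x ≟ w ⟧ ℕ.+ ⟦ smaller ×-dec x ≟ v ⟧)
      ≡⟨ exchange-balance ⟩
    ⟦ entry T′ x ℕ.≟ b ⟧ ℕ.+ (⟦ larger ×-dec x ≟ v ⟧ ℕ.+ ⟦ smaller ×-dec x ≟ w ⟧)
      ≡⟨ cong (⟦ entry T′ x ℕ.≟ b ⟧ ℕ.+_) (cong₂ ℕ._+_ left-down left-up) ⟨
    ⟦ entry T′ x ℕ.≟ b ⟧ ℕ.+ losses f b x ∎
    where
    open ≡-Reasoning
    T′ = exchange v w T
    f = λ a b y z → ⟦ swap? T T′ a b y z ⟧
    larger  = entry T v ℕ.≟ b
    smaller = entry T w ℕ.≟ b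
    v⋖w = exchangeable-⋖ U e
    descent = Exchangeable.descent e
    v≢w = ⋖⇒≢ v⋖w

    ∈below : entry T v ≡ b → entry T w ∈ below b
    ∈below refl = ∈-below (s≤s descent)
    ∈above : entry T w ≡ b → entry T v ∈ above-to n b
    ∈above refl = ∈-above (s≤s descent) (Fin.toℕ<n (T v))

    moved-down : ∑ (below b) (λ c → ∑ (N⁻ x) (λ y → f c b x y)) ≡ ⟦ larger ×-dec x ≟ w ⟧
    moved-down = ∑∑-unique (larger ×-dec x ≟ w) (λ c y → swap? T T′ c b x y) ℕ._≟_ (below-! b) (N⁻-! x)
      (entry T w) v
      (λ c∈ s → case exchanged U e inj (below-< c∈) s of λ { (refl , refl) →
        (proj₁ (proj₂ s) , refl) , sym (proj₁ s) , refl })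
      (λ { (Tv , refl) → exchanged⁻ U e refl Tv , ∈below Tv , ∈N⁻ v⋖w })

    moved-up : ∑ (above-to n b) (λ c → ∑ (N⁺ x) (λ y → f b c y x)) ≡ ⟦ smaller ×-dec x ≟ v ⟧
    moved-up = ∑∑-unique (smaller ×-dec x ≟ v) (λ c y → swap? T T′ b c y x) ℕ._≟_ (above-! n b) (N⁺-! x)
      (entry T v) w
      (λ c∈ s → case exchanged U e inj (above-> {n} c∈) s of λ { (refl , refl) →
        (proj₁ s , refl) , sym (proj₁ (proj₂ s)) , refl })
      (λ { (Tw , refl) → exchanged⁻ U e Tw refl , ∈above Tw , ∈N⁺ v⋖w })

    left-down : ∑ (below b) (λ c → ∑ (N⁺ x) (λ y → f c b y x)) ≡ ⟦ larger ×-dec x ≟ v ⟧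
    left-down = ∑∑-unique (larger ×-dec x ≟ v) (λ c y → swap? T T′ c b y x) ℕ._≟_ (below-! b) (N⁺-! x)
      (entry T w) w
      (λ c∈ s → case exchanged U e inj (below-< c∈) s of λ { (refl , refl) →
        (proj₁ (proj₂ s) , refl) , sym (proj₁ s) , refl })
      (λ { (Tv , refl) → exchanged⁻ U e refl Tv , ∈below Tv , ∈N⁺ v⋖w })

    left-up : ∑ (above-to n b) (λ c → ∑ (N⁻ x) (λ y → f b c x y)) ≡ ⟦ smaller ×-dec x ≟ w ⟧
    left-up = ∑∑-unique (smaller ×-dec x ≟ w) (λ c y → swap? T T′ b c x y) ℕ._≟_ (above-! n b) (N⁻-! x)
      (entry T v) v
      (λ c∈ s → case exchanged U e inj (above-> {n} c∈) s of λ { (refl , refl) →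
        (proj₁ s , refl) , sym (proj₁ (proj₂ s)) , refl })
      (λ { (Tw , refl) → exchanged⁻ U e Tw refl , ∈above Tw , ∈N⁻ v⋖w })

    exchange-balance :
      ⟦ entry T x ℕ.≟ b ⟧ ℕ.+ (⟦ larger ×-dec x ≟ w ⟧ ℕ.+ ⟦ smaller ×-dec x ≟ v ⟧) ≡
      ⟦ entry T′ x ℕ.≟ b ⟧ ℕ.+ (⟦ larger ×-dec x ≟ v ⟧ ℕ.+ ⟦ smaller ×-dec x ≟ w ⟧)
    exchange-balance
      rewrite ⟦⟧-× larger (x ≟ w) | ⟦⟧-× smaller (x ≟ v) | ⟦⟧-× larger (x ≟ v) | ⟦⟧-× smaller (x ≟ w)
      with x ≟ v | x ≟ w
    ... | yes refl | yes refl = contradiction refl v≢w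
    ... | yes refl | no _     = solve 2
      (λ l s → l :+ (l :* con 0 :+ s :* con 1) := s :+ (l :* con 1 :+ s :* con 0))
      refl ⟦ larger ⟧ ⟦ smaller ⟧
    ... | no _     | yes refl = solve 2
      (λ l s → s :+ (l :* con 1 :+ s :* con 0) := l :+ (l :* con 0 :+ s :* con 1))
      refl ⟦ larger ⟧ ⟦ smaller ⟧
    ... | no _     | no _     = refl

  -- Gains and losses of b at x along a run account for the change of [T x = b].  By `exchanges-once`
  -- the indicator that a pair is exchanged in a run is additive over the steps.
  balance : ∀ {k w T} → Injective _≡_ _≡_ T → Sliding U k w T → (run : Run U T) → ∀ b x →
    ⟦ entry T x ℕ.≟ b ⟧ ℕ.+ gains (λ a b y z → ⟦ exchanges? a b y z run ⟧) b x ≡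
    ⟦ entry (final run) x ℕ.≟ b ⟧ ℕ.+ losses (λ a b y z → ⟦ exchanges? a b y z run ⟧) b x
  balance {T = T} inj sl (stop _) b x =
    cong (⟦ entry T x ℕ.≟ b ⟧ ℕ.+_) (cong₂ ℕ._+_
      (trans (∑-zero (below b) λ _ → ∑-zero (N⁻ x) λ _ → refl)
             (sym (∑-zero (below b) λ _ → ∑-zero (N⁺ x) λ _ → refl)))
      (trans (∑-zero (above-to n b) λ _ → ∑-zero (N⁺ x) λ _ → refl)
             (sym (∑-zero (above-to n b) λ _ → ∑-zero (N⁻ x) λ _ → refl))))
  balance {T = T} inj sl run@(step v w _ next rest) b x = begin
    ⟦ entry T x ℕ.≟ b ⟧ ℕ.+ gains (λ a b y z → ⟦ exchanges? a b y z run ⟧) b x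
      ≡⟨ cong (⟦ entry T x ℕ.≟ b ⟧ ℕ.+_) (gains-+ {g = first} {h = later} split b x) ⟩
    ⟦ entry T x ℕ.≟ b ⟧ ℕ.+ (gains first b x ℕ.+ gains later b x)
      ≡⟨ ℕ.+-assoc ⟦ entry T x ℕ.≟ b ⟧ (gains first b x) _ ⟨
    ⟦ entry T x ℕ.≟ b ⟧ ℕ.+ gains first b x ℕ.+ gains later b x
      ≡⟨ cong (ℕ._+ gains later b x) (balance-step inj exchangeable b x) ⟩
    ⟦ entry T′ x ℕ.≟ b ⟧ ℕ.+ losses first b x ℕ.+ gains later b x
      ≡⟨ swap-last ⟦ entry T′ x ℕ.≟ b ⟧ (losses first b x) _ ⟩
    ⟦ entry T′ x ℕ.≟ b ⟧ ℕ.+ gains later b x ℕ.+ losses first b x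
      ≡⟨ cong (ℕ._+ losses first b x) (balance (exchange-injective v w inj)
           (sliding-step U inj exchangeable (proj₁ (proj₂ current)) (proj₂ (proj₂ current))) rest b x) ⟩
    ⟦ entry (final rest) x ℕ.≟ b ⟧ ℕ.+ losses later b x ℕ.+ losses first b x
      ≡⟨ swap-last ⟦ entry (final rest) x ℕ.≟ b ⟧ (losses later b x) _ ⟩
    ⟦ entry (final rest) x ℕ.≟ b ⟧ ℕ.+ losses first b x ℕ.+ losses later b x
      ≡⟨ ℕ.+-assoc ⟦ entry (final rest) x ℕ.≟ b ⟧ (losses first b x) _ ⟩
    ⟦ entry (final rest) x ℕ.≟ b ⟧ ℕ.+ (losses first b x ℕ.+ losses later b x)
      ≡⟨ cong (⟦ entry (final rest) x ℕ.≟ b ⟧ ℕ.+_) (losses-+ {g = first} {h = later} split b x) ⟨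
    ⟦ entry (final rest) x ℕ.≟ b ⟧ ℕ.+ losses (λ a b y z → ⟦ exchanges? a b y z run ⟧) b x ∎
    where
    open ≡-Reasoning
    open NextExchange next
    T′ = exchange v w T
    first later : ℕ → ℕ → Cell p → Cell p → ℕ
    first a b y z = ⟦ swap? T T′ a b y z ⟧
    later a b y z = ⟦ exchanges? a b y z rest ⟧
    current = phase-sliding U (phase U inj sl next)
    swap-last : ∀ a b c → a ℕ.+ b ℕ.+ c ≡ a ℕ.+ c ℕ.+ b
    swap-last = solve 3 (λ a b c → a :+ b :+ c := a :+ c :+ b) refl
    split : ∀ {a b} y z → a < b → ⟦ exchanges? a b y z run ⟧ ≡ first a b y z ℕ.+ later a b y z
    split {a} {b} y z a<b =
      ⟦⟧-⊎ (swap? T T′ a b y z) (exchanges? a b y z rest) (exchanges-once U inj sl next rest a<b)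

  -- The balance summed over all tableaux.
  balance-total : ∀ b x → 1 ≤ b → b ≤ n →
    (n ∸ 1) ! ℕ.+ gains (exchangeNumber U) b x ≡ ω U b x ℕ.+ losses (exchangeNumber U) b x
  balance-total (suc b) x _ b<n = begin
    (n ∸ 1) ! ℕ.+ gains (exchangeNumber U) (suc b) x
      ≡⟨ cong₂ ℕ._+_ (sym (trans (∑-cong (tableaux p) (λ (T , _) → initial T))
                                 (count-entry U x (fromℕ< b<n))))
                     gains-total ⟩
    ∑ (tableaux p) (λ (T , _) → ⟦ entry T x ℕ.≟ suc b ⟧) ℕ.+
    ∑ (tableaux p) (λ T → gains (exchanged? T) (suc b) x)
      ≡⟨ ∑-+ (tableaux p) _ _ ⟨
    ∑ (tableaux p) (λ T → ⟦ entry (proj₁ T) x ℕ.≟ suc b ⟧ ℕ.+ gains (exchanged? T) (suc b) x)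
      ≡⟨ ∑-cong (tableaux p) (λ T → balance (proj₁ (proj₂ T)) (sliding-start U {x}) (run U T) (suc b) x) ⟩
    ∑ (tableaux p) (λ T → ⟦ entry (φ U T) x ℕ.≟ suc b ⟧ ℕ.+ losses (exchanged? T) (suc b) x)
      ≡⟨ ∑-+ (tableaux p) _ _ ⟩
    ∑ (tableaux p) (λ T → ⟦ entry (φ U T) x ℕ.≟ suc b ⟧) ℕ.+
    ∑ (tableaux p) (λ T → losses (exchanged? T) (suc b) x)
      ≡⟨ cong₂ ℕ._+_ (sym (length-filter-∑ (λ T → entry (φ U T) x ℕ.≟ suc b) (tableaux p))) losses-total ⟩
    ω U (suc b) x ℕ.+ losses (exchangeNumber U) (suc b) x ∎
    where
    open ≡-Reasoning
    exchanged? : Tableau p → ℕ → ℕ → Cell p → Cell p → ℕ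
    exchanged? T a b y z = ⟦ exchanges? a b y z (run U T) ⟧
    initial : ∀ T → ⟦ entry T x ℕ.≟ suc b ⟧ ≡ ⟦ T x Fin.≟ fromℕ< b<n ⟧
    initial T = ⟦⟧-cong (entry T x ℕ.≟ suc b) (T x Fin.≟ fromℕ< b<n)
      (λ e → Fin.toℕ-injective (trans (ℕ.suc-injective e) (sym (Fin.toℕ-fromℕ< b<n))))
      (λ e → cong suc (trans (cong toℕ e) (Fin.toℕ-fromℕ< b<n)))
    count : ∀ a b y z → exchangeNumber U a b y z ≡ ∑ (tableaux p) (λ T → exchanged? T a b y z)
    count a b y z = length-filter-∑ (λ T → exchanges? a b y z (run U T)) (tableaux p)
    gains-total : gains (exchangeNumber U) (suc b) x ≡
                  ∑ (tableaux p) (λ T → gains (exchanged? T) (suc b) x)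
    gains-total = trans
      (cong₂ ℕ._+_ (∑-cong (below (suc b)) λ c → ∑-cong (N⁻ x) λ y → count c (suc b) x y)
                   (∑-cong (above-to n (suc b)) λ c → ∑-cong (N⁺ x) λ y → count (suc b) c y x))
      (sym (∑-gains (tableaux p) exchanged? (suc b) x))
    losses-total : ∑ (tableaux p) (λ T → losses (exchanged? T) (suc b) x) ≡
                   losses (exchangeNumber U) (suc b) x
    losses-total = trans (∑-losses (tableaux p) exchanged? (suc b) x)
      (cong₂ ℕ._+_ (∑-cong (below (suc b)) λ c → ∑-cong (N⁺ x) λ y → sym (count c (suc b) y x))
                   (∑-cong (above-to n (suc b)) λ c → ∑-cong (N⁻ x) λ y → sym (count (suc b) c x y)))

  -- By independence of the larger entry, all n - b partners above b contribute equally.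
  gains-exchangeNumber : ∀ {b} x → b ≤ n → gains (exchangeNumber U) b x ≡
    ∑ (below b) (λ a → ∑ (N⁻ x) (λ y → m U a x y)) ℕ.+ (n ∸ b) ℕ.* ∑ (N⁺ x) (λ y → m U b y x)
  gains-exchangeNumber x b≤n = cong₂ ℕ._+_
    (∑-cong-∈ λ c∈ → ∑-cong (N⁻ x) λ y → exchangeNumber-≡-m U x y (below-< c∈) b≤n)
    (∑-above λ c∈ → ∑-cong (N⁺ x) λ y → exchangeNumber-≡-m U y x (above-> {n} c∈) (above-≤ b≤n c∈))

  losses-exchangeNumber : ∀ {b} x → b ≤ n → losses (exchangeNumber U) b x ≡
    ∑ (below b) (λ a → ∑ (N⁺ x) (λ y → m U a y x)) ℕ.+ (n ∸ b) ℕ.* ∑ (N⁻ x) (λ y → m U b x y)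
  losses-exchangeNumber x b≤n = cong₂ ℕ._+_
    (∑-cong-∈ λ c∈ → ∑-cong (N⁺ x) λ y → exchangeNumber-≡-m U y x (below-< c∈) b≤n)
    (∑-above λ c∈ → ∑-cong (N⁻ x) λ y → exchangeNumber-≡-m U x y (above-> {n} c∈) (above-≤ b≤n c∈))

-- The recursion for the signed exit numbers

solve-for-exit : ∀ d f w a b c e → f ℕ.+ (a ℕ.+ d ℕ.* b) ≡ w ℕ.+ (c ℕ.+ d ℕ.* e) →
  + d * (+ e - + b) ≡ + f - + w + (+ a - + c)
solve-for-exit d f w a b c e eq = begin
  + d * (+ e - + b)
    ≡⟨ ℤS.solve 5 (λ d e b w c → d ℤS.:* (e ℤS.:- b) ℤS.:=
         (w ℤS.:+ (c ℤS.:+ d ℤS.:* e)) ℤS.:- (w ℤS.:+ (c ℤS.:+ d ℤS.:* b)))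
         refl (+ d) (+ e) (+ b) (+ w) (+ c) ⟩
  (+ w + (+ c + + d * + e)) - (+ w + (+ c + + d * + b))
    ≡⟨ cong (_- (+ w + (+ c + + d * + b))) (trans (sym (pos w c e)) (trans (cong +_ (sym eq)) (pos f a b))) ⟩
  (+ f + (+ a + + d * + b)) - (+ w + (+ c + + d * + b))
    ≡⟨ ℤS.solve 6 (λ d f b w c a → (f ℤS.:+ (a ℤS.:+ d ℤS.:* b)) ℤS.:- (w ℤS.:+ (c ℤS.:+ d ℤS.:* b)) ℤS.:=
         (f ℤS.:- w) ℤS.:+ (a ℤS.:- c))
         refl (+ d) (+ f) (+ b) (+ w) (+ c) (+ a) ⟩
  + f - + w + (+ a - + c) ∎
  where
  open ≡-Reasoning
  pos : ∀ x y z → + (x ℕ.+ (y ℕ.+ d ℕ.* z)) ≡ + x + (+ y + + d * + z)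
  pos x y z = trans (ℤ.pos-+ x _) (cong (_+_ (+ x)) (trans (ℤ.pos-+ y _) (cong (_+_ (+ y)) (ℤ.pos-* d z))))

theorem5p3 : (n : ℕ) (p : Partition n) (U : SYT p) (x : Cell p) (b : ℕ) → 1 ≤ b → b ≤ n →
    (+ n - + b) * Δ U b x ≡
    + ((n ∸ 1) !) - + ω U b x + sumℤ (map (λ a → Δ U a x) (applyUpTo suc (b ∸ 1)))
theorem5p3 n p U x b 1≤b b≤n = begin
  (+ n - + b) * Δ U b x
    ≡⟨ cong (_* Δ U b x) (trans (ℤ.m-n≡m⊖n n b) (ℤ.⊖-≥ b≤n)) ⟩
  + (n ∸ b) * (+ E⁻ - + E⁺)
    ≡⟨ solve-for-exit (n ∸ b) ((n ∸ 1) !) (ω U b x) A⁻ E⁺ A⁺ E⁻ (begin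
         (n ∸ 1) ! ℕ.+ (A⁻ ℕ.+ (n ∸ b) ℕ.* E⁺)     ≡⟨ cong ((n ∸ 1) ! ℕ.+_) (gains-exchangeNumber U x b≤n) ⟨
         (n ∸ 1) ! ℕ.+ gains (exchangeNumber U) b x ≡⟨ balance-total U b x 1≤b b≤n ⟩
         ω U b x ℕ.+ losses (exchangeNumber U) b x  ≡⟨ cong (ω U b x ℕ.+_) (losses-exchangeNumber U x b≤n) ⟩
         ω U b x ℕ.+ (A⁺ ℕ.+ (n ∸ b) ℕ.* E⁻)        ∎) ⟩
  + ((n ∸ 1) !) - + ω U b x + (+ A⁻ - + A⁺)
    ≡⟨ cong (_+_ (+ ((n ∸ 1) !) - + ω U b x)) (sumℤ-∑ _ _ (below b)) ⟨
  + ((n ∸ 1) !) - + ω U b x + sumℤ (map (λ a → Δ U a x) (applyUpTo suc (b ∸ 1))) ∎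
  where
  open ≡-Reasoning
  A⁻ = ∑ (below b) (λ a → ∑ (N⁻ x) (λ y → m U a x y))
  A⁺ = ∑ (below b) (λ a → ∑ (N⁺ x) (λ y → m U a y x))
  E⁻ = ∑ (N⁻ x) (λ y → m U b x y)
  E⁺ = ∑ (N⁺ x) (λ y → m U b y x)
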